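{- The algebra $(\mathcal{T}_\bullet,\hat{\ast})$ is a free associative algebra, freely generated by the set of non-empty reduced set compositions in $\mathsf{Comp}=\bigcup_{n\ge0}\mathsf{Comp}_n$.
   Context: $[n]=\{1,\ldots,n\}$. A set composition of a finite set $S\subset\mathbb{N}$ is a tuple $(P_1,\ldots,P_k)$ of pairwise disjoint non-empty subsets with union $S$; $\mathsf{Comp}_n$ is the set of set compositions of $[n]$ ($\mathsf{Comp}_0=\{\text{empty tuple}\}$). $\mathcal{T}_n$ is the free $\mathbb{Z}$-module on $\mathsf{Comp}_n$, $\mathcal{T}_\bullet=\bigoplus_{n\ge0}\mathcal{T}_n$. For finite $S,T\subset\mathbb{N}$ with $|S|=|T|$, $\mathsf{is}_{S,T}$ maps a set composition of $S$ to one of $T$ by applying the order-preserving bijection $S\to T$ blockwise. For set compositions $P$ of $S$ and $Q$ of $T$ with $S\cap T=\emptyset$, $P\ast Q$ is the concatenated tuple. The symmetrized product is defined bilinearly, for $P\in\mathsf{Comp}_p$, $Q\in\mathsf{Comp}_q$, by $P\,\hat{\ast}\,Q=\sum\mathsf{is}_{[p],A}(P)\ast\mathsf{is}_{[q],B}(Q)$, summed over all ordered pairs $(A,B)$ with $A\sqcup B=[p+q]$, $|A|=p$, $|B|=q$; its unit is the empty tuple. A set composition $(P_1,\ldots,P_k)\in\mathsf{Comp}_n$ is reduced if there is no $(a,m)$ with $1\le a<k$, $m<n$ and $P_1\cup\cdots\cup P_a=[m]$. -}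

module Defs where

open import Algebra.Bundles using (Ring; RawRing)
open import Algebra.Morphism.Structures using (IsRingHomomorphism)
open import Algebra.Structures using (IsRing)
import Data.Bool.Properties as Bool
open import Data.Bool.Base using (if_then_else_)
open import Data.Fin.Base using (toℕ)
open import Data.Fin.Subset
open import Data.Fin.Subset.Properties
open import Data.Integer.Base as ℤ using (ℤ; 0ℤ; 1ℤ)
open import Data.List.Base as List
  using (List; []; _∷_; _++_; map; concatMap; mapMaybe; length; take)
import Data.List.Properties as List
open import Data.List.Relation.Unary.All as All using (All; []; _∷_)
import Data.List.Relation.Unary.All.Properties as All
open import Data.List.Relation.Unary.AllPairs as AllPairs using (AllPairs; []; _∷_)
import Data.List.Relation.Unary.AllPairs.Properties as AllPairs
import Data.Maybe.Base as Maybe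
open import Data.Nat.Base using (ℕ; zero; suc; _+_; _∸_; _≤_; _<_)
import Data.Nat.Properties as ℕ
open import Data.Product.Base using (Σ; Σ-syntax; ∃-syntax; _×_; _,_)
open import Data.Vec.Base as Vec using ([]; _∷_; here; there)
import Data.Vec.Properties as Vec
open import Function.Base using (_∘_)
open import Level using (Level; _⊔_) renaming (suc to lsuc)
open import Relation.Binary.Definitions using (DecidableEquality)
open import Relation.Binary.PropositionalEquality
open import Relation.Nullary using (¬_; yes; no; does)
open import Relation.Nullary.Decidable using (dec⇒maybe)

private
  variable
    n p q : ℕ

-- The ground set [n] = {1,…,n} is modelled, as an ordered set, by Fin n;
-- the number i + 1 corresponds to the element i of Fin n.

infix 4 _#_

_#_ : Subset n → Subset n → Set
A # B = Empty (A ∩ B)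

record IsSetComposition (S : Subset n) (Ps : List (Subset n)) : Set where
  field
    nonempty : All Nonempty Ps
    disjoint : AllPairs _#_ Ps
    union    : ⋃ Ps ≡ S

-- The validity proof is irrelevant, so that propositional equality of set
-- compositions is equality of the underlying tuples of blocks.

record SetComposition (S : Subset n) : Set where
  constructor setComposition
  field
    blocks            : List (Subset n)
    .isSetComposition : IsSetComposition S blocks

open SetComposition public using (blocks)

Comp : ℕ → Set
Comp n = SetComposition (⊤ {n})

-- If a₀ < a₁ < … are the elements of A, then relabel A X = { aᵢ ∣ i ∈ X },
-- the image of X under the order-preserving bijection [ ∣ A ∣ ] → A.

relabel : (A : Subset n) → Subset ∣ A ∣ → Subset n
relabel []            X       = []
relabel (outside ∷ A) X       = outside ∷ relabel A X
relabel (inside  ∷ A) (x ∷ X) = x ∷ relabel A X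

relabel-⊥ : (A : Subset n) → relabel A ⊥ ≡ ⊥
relabel-⊥ []            = refl
relabel-⊥ (outside ∷ A) = cong (outside ∷_) (relabel-⊥ A)
relabel-⊥ (inside  ∷ A) = cong (outside ∷_) (relabel-⊥ A)

relabel-⊤ : (A : Subset n) → relabel A ⊤ ≡ A
relabel-⊤ []            = refl
relabel-⊤ (outside ∷ A) = cong (outside ∷_) (relabel-⊤ A)
relabel-⊤ (inside  ∷ A) = cong (inside ∷_) (relabel-⊤ A)

relabel-∪ : (A : Subset n) (X Y : Subset ∣ A ∣) →
            relabel A (X ∪ Y) ≡ relabel A X ∪ relabel A Y
relabel-∪ []            X       Y       = refl
relabel-∪ (outside ∷ A) X       Y       = cong (outside ∷_) (relabel-∪ A X Y)
relabel-∪ (inside  ∷ A) (x ∷ X) (y ∷ Y) = cong (_ ∷_) (relabel-∪ A X Y)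

relabel-∩ : (A : Subset n) (X Y : Subset ∣ A ∣) →
            relabel A (X ∩ Y) ≡ relabel A X ∩ relabel A Y
relabel-∩ []            X       Y       = refl
relabel-∩ (outside ∷ A) X       Y       = cong (outside ∷_) (relabel-∩ A X Y)
relabel-∩ (inside  ∷ A) (x ∷ X) (y ∷ Y) = cong (_ ∷_) (relabel-∩ A X Y)

relabel-⋃ : (A : Subset n) (Ps : List (Subset ∣ A ∣)) →
            ⋃ (map (relabel A) Ps) ≡ relabel A (⋃ Ps)
relabel-⋃ A []       = sym (relabel-⊥ A)
relabel-⋃ A (X ∷ Ps) = trans (cong (relabel A X ∪_) (relabel-⋃ A Ps))
                             (sym (relabel-∪ A X (⋃ Ps)))

relabel-nonempty⁺ : (A : Subset n) {X : Subset ∣ A ∣} →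
                    Nonempty X → Nonempty (relabel A X)
relabel-nonempty⁺ (outside ∷ A) ne with relabel-nonempty⁺ A ne
... | _ , i∈ = _ , there i∈
relabel-nonempty⁺ (inside ∷ A) {x ∷ X} (_ , here) = _ , here
relabel-nonempty⁺ (inside ∷ A) {x ∷ X} (_ , there i∈) with relabel-nonempty⁺ A (_ , i∈)
... | _ , j∈ = _ , there j∈

relabel-nonempty⁻ : (A : Subset n) {X : Subset ∣ A ∣} →
                    Nonempty (relabel A X) → Nonempty X
relabel-nonempty⁻ (outside ∷ A) (_ , there i∈) = relabel-nonempty⁻ A (_ , i∈)
relabel-nonempty⁻ (inside ∷ A) {x ∷ X} (_ , here) = _ , here
relabel-nonempty⁻ (inside ∷ A) {x ∷ X} (_ , there i∈) with relabel-nonempty⁻ A (_ , i∈)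
... | _ , j∈ = _ , there j∈

is′ : (A : Subset n) → Comp ∣ A ∣ → SetComposition A
is′ A (setComposition Ps ok) = setComposition (map (relabel A) Ps) (valid ok)
  where
  open IsSetComposition
  valid : IsSetComposition ⊤ Ps → IsSetComposition A (map (relabel A) Ps)
  valid ok .nonempty = All.map⁺ (All.map (relabel-nonempty⁺ A) (ok .nonempty))
  valid ok .disjoint = AllPairs.map⁺ (AllPairs.map
    (λ {X} {Y} X#Y → X#Y ∘ relabel-nonempty⁻ A ∘ subst Nonempty (sym (relabel-∩ A X Y)))
    (ok .disjoint))
  valid ok .union = trans (relabel-⋃ A Ps)
                          (trans (cong (relabel A) (ok .union)) (relabel-⊤ A))

-- is_{[p],A}

is : (A : Subset n) → ∣ A ∣ ≡ p → Comp p → SetComposition A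
is A refl = is′ A

⋃-++ : (Ps Qs : List (Subset n)) → ⋃ (Ps ++ Qs) ≡ ⋃ Ps ∪ ⋃ Qs
⋃-++ []       Qs = sym (∪-identityˡ (⋃ Qs))
⋃-++ (X ∷ Ps) Qs = trans (cong (X ∪_) (⋃-++ Ps Qs)) (sym (∪-assoc X (⋃ Ps) (⋃ Qs)))

⋃-upper : (Ps : List (Subset n)) → All (_⊆ ⋃ Ps) Ps
⋃-upper []       = []
⋃-upper (X ∷ Ps) = p⊆p∪q (⋃ Ps) ∷
  All.map {P = _⊆ ⋃ Ps} {Q = _⊆ (X ∪ ⋃ Ps)}
    (λ Y⊆ {_} y∈ → q⊆p∪q X (⋃ Ps) (Y⊆ y∈)) (⋃-upper Ps)

#-mono : {A B X Y : Subset n} → X ⊆ A → Y ⊆ B → A # B → X # Y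
#-mono {X = X} {Y} X⊆A Y⊆B A#B (i , i∈) with x∈p∩q⁻ X Y i∈
... | i∈X , i∈Y = A#B (i , x∈p∩q⁺ (X⊆A i∈X , Y⊆B i∈Y))

concatenate : {A B S : Subset n} → .(A # B) → .(A ∪ B ≡ S) →
              SetComposition A → SetComposition B → SetComposition S
concatenate {A = A} {B} {S} A#B A∪B≡S (setComposition Ps okP) (setComposition Qs okQ) =
  setComposition (Ps ++ Qs) (valid A#B A∪B≡S okP okQ)
  where
  open IsSetComposition
  valid : A # B → A ∪ B ≡ S → IsSetComposition A Ps → IsSetComposition B Qs →
          IsSetComposition S (Ps ++ Qs)
  valid A#B A∪B≡S okP okQ .nonempty = All.++⁺ (okP .nonempty) (okQ .nonempty)
  valid A#B A∪B≡S okP okQ .disjoint = AllPairs.++⁺ (okP .disjoint) (okQ .disjoint)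
    (All.map {P = _⊆ ⋃ Ps} (λ {X} X⊆ → All.map {P = _⊆ ⋃ Qs} (λ {Y} Y⊆ →
        #-mono {X = X} {Y} (subst (X ⊆_) (okP .union) X⊆)
                           (subst (Y ⊆_) (okQ .union) Y⊆) A#B)
      (⋃-upper Qs)) (⋃-upper Ps))
  valid A#B A∪B≡S okP okQ .union =
    trans (⋃-++ Ps Qs) (trans (cong₂ _∪_ (okP .union) (okQ .union)) A∪B≡S)

subsets : ∀ n → List (Subset n)
subsets zero    = [] ∷ []
subsets (suc n) = map (inside ∷_) (subsets n) ++ map (outside ∷_) (subsets n)

#-∁ : (A : Subset n) → A # ∁ A
#-∁ A = subst Empty (sym (∩-inverseʳ A)) λ (_ , i∈) → ∉⊥ i∈

∣∁A∣≡q : (A : Subset (p + q)) → ∣ A ∣ ≡ p → ∣ ∁ A ∣ ≡ q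
∣∁A∣≡q {p} {q} A ∣A∣≡p =
  trans (∣∁p∣≡n∸∣p∣ A) (trans (cong (p + q ∸_) ∣A∣≡p) (ℕ.m+n∸m≡n p q))

-- The list of terms of P ∗̂ Q, one for each ordered pair (A , B) with
-- A ⊔ B = [p + q], ∣ A ∣ = p and ∣ B ∣ = q; such a B is the complement of A.

terms : Comp p → Comp q → List (Comp (p + q))
terms {p} {q} P Q = mapMaybe
  (λ A → Maybe.map (term A) (dec⇒maybe (∣ A ∣ ℕ.≟ p)))
  (subsets (p + q))
  where
  term : (A : Subset (p + q)) → ∣ A ∣ ≡ p → Comp (p + q)
  term A ∣A∣≡p = concatenate (#-∁ A) (p∪∁p≡⊤ A)
    (is A ∣A∣≡p P) (is (∁ A) (∣∁A∣≡q {p} {q} A ∣A∣≡p) Q)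

AllComp : Set
AllComp = Σ ℕ Comp

_≟_ : DecidableEquality AllComp
(m , setComposition Ps _) ≟ (n , setComposition Qs _) with m ℕ.≟ n
... | no m≢n   = no λ { refl → m≢n refl }
... | yes refl with List.≡-dec (Vec.≡-dec Bool._≟_) Ps Qs
...   | yes refl = yes refl
...   | no Ps≢Qs = no λ { refl → Ps≢Qs refl }

∅ : AllComp
∅ = 0 , setComposition [] (record { nonempty = [] ; disjoint = [] ; union = refl })

-- ⨁ₙ 𝒯ₙ is the free ℤ-module on the disjoint union of the Compₙ. Its elements
-- are represented by finite formal sums (repetitions and zero coefficients
-- allowed), and two such sums are equal when all their coefficients agree.

T : Set
T = List (ℤ × AllComp)

coeff : T → AllComp → ℤ
coeff []            P = 0ℤ
coeff ((a , Q) ∷ x) P = (if does (Q ≟ P) then a else 0ℤ) ℤ.+ coeff x P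

infix 4 _≈_
_≈_ : T → T → Set
x ≈ y = ∀ P → coeff x P ≡ coeff y P

-_ : T → T
-_ = map λ (a , P) → ℤ.- a , P

⟨_⟩ : AllComp → T
⟨ P ⟩ = (1ℤ , P) ∷ []

infixl 7 _∗̂_
_∗̂_ : T → T → T
x ∗̂ y = concatMap (λ (a , (p , P)) →
        concatMap (λ (b , (q , Q)) →
        map (λ R → a ℤ.* b , (p + q , R)) (terms P Q)) y) x

𝓣 : RawRing _ _
𝓣 = record
  { Carrier = T
  ; _≈_     = _≈_
  ; _+_     = _++_
  ; _*_     = _∗̂_
  ; -_      = -_
  ; 0#      = []
  ; 1#      = ⟨ ∅ ⟩
  }

-- The subset [m] of [n], for m ≤ n.

initial : ∀ n → ℕ → Subset n
initial n m = Vec.tabulate λ i → does (toℕ i ℕ.<? m)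

Reduced : AllComp → Set
Reduced (n , P) = ¬ (∃[ a ] ∃[ m ] 1 ≤ a × a < length (blocks P) × m < n ×
                     ⋃ (take a (blocks P)) ≡ initial n m)

record Generator : Set where
  constructor generator
  field
    composition : AllComp
    .nonempty   : composition ≢ ∅
    .reduced    : Reduced composition

open Generator public using (composition)

-- An associative unital ℤ-algebra is the same thing as a ring, and a ℤ-algebra
-- homomorphism the same thing as a unital ring homomorphism. So the universal
-- property of the free associative ℤ-algebra on X, with insertion of
-- generators ι, quantifies over all rings S.

record IsFreeAlgebra {r ℓr x} (R : RawRing r ℓr) {X : Set x}
                     (ι : X → RawRing.Carrier R) (c ℓ : Level)
                     : Set (r ⊔ ℓr ⊔ x ⊔ lsuc (c ⊔ ℓ)) where
  private module R = RawRing R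

  Extends : (S : Ring c ℓ) → (X → Ring.Carrier S) → (R.Carrier → Ring.Carrier S) →
            Set (r ⊔ ℓr ⊔ x ⊔ ℓ)
  Extends S f φ = IsRingHomomorphism R (Ring.rawRing S) φ ×
                  (∀ x → Ring._≈_ S (φ (ι x)) (f x))

  field
    isRing : IsRing R._≈_ R._+_ R._*_ R.-_ R.0# R.1#
    extend : (S : Ring c ℓ) (f : X → Ring.Carrier S) →
             Σ[ φ ∈ (R.Carrier → Ring.Carrier S) ]
               Extends S f φ ×
               (∀ ψ → Extends S f ψ → ∀ t → Ring._≈_ S (ψ t) (φ t))

{-# OPTIONS --safe #-}

-- Reading the blocks of a set composition of [n] as the columns of an incidence matrix, ∗̂
-- becomes the shuffle product of words (after padding the columns with zeros), so it is
-- associative.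
--
-- Call a non-empty union of leading blocks a break if it is an initial segment [m]. Cutting at
-- its first break writes every P ≠ ∅ uniquely as a shifted concatenation G ▷ Q with G a
-- generator. In G ∗̂ Q the pair (A , B) with A = [p] contributes G ▷ Q. For any other A there is
-- no break inside G, because G is reduced, nor at its end, because A is not initial, so that
-- term has at most as many breaks as Q, hence fewer than G ▷ Q. Thus
-- φ(G ▷ Q) = f(G) φ(Q) − ∑ φ(other terms) defines φ recursively, and forces it. As φ is then
-- multiplicative for left factors G, induction on the number of breaks makes it multiplicative.

module Submission where

open import Defs
open import Algebra.Bundles using (Ring)
open import Algebra.Morphism.Structures using (IsRingHomomorphism)
import Algebra.Properties.AbelianGroup as AbelianGroupProperties
import Algebra.Properties.CommutativeSemigroup as CommutativeSemigroupProperties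
import Algebra.Properties.Ring as RingProperties
import Algebra.Properties.Semiring.Mult as Mult
open import Algebra.Structures using (IsRing)
open import Data.Bool.Base using (Bool; if_then_else_)
import Data.Bool.Properties as Bool
open import Data.Empty using (⊥-elim-irr) renaming (⊥ to Absurd)
open import Data.Fin.Subset
  using (Subset; inside; outside; ∁; ∣_∣; ⊥; ⊤; _∪_; _∩_; ⋃; Nonempty; _⊆_; _∈_)
open import Data.Fin.Subset.Properties
open import Data.Integer.Base as ℤ using (ℤ; 0ℤ; 1ℤ; +_; -[1+_])
import Data.Integer.Properties as ℤ
open import Data.List.Base
  using (List; []; _∷_; _++_; map; concatMap; mapMaybe; filter; length; replicate; take; drop)
open import Data.List.Membership.Propositional using () renaming (_∈_ to _∈ˡ_)
import Data.List.Properties as List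
open import Data.List.Relation.Unary.All as All using (All; []; _∷_)
import Data.List.Relation.Unary.All.Properties as All
open import Data.List.Relation.Unary.AllPairs as AllPairs using (AllPairs; []; _∷_; allPairs?)
import Data.List.Relation.Unary.AllPairs.Properties as AllPairs
open import Data.List.Relation.Unary.Any as Any using (here; there)
import Data.List.Relation.Unary.Any.Properties as Any
import Data.Maybe.Base as Maybe
open import Data.Nat.Base as ℕ using (ℕ; zero; suc; _≤_; _<_; z≤n; s≤s)
import Data.Nat.Properties as ℕ
open import Data.Product.Base using (Σ-syntax; ∃-syntax; _×_; _,_; proj₁; proj₂)
import Data.Product.Properties as Product
open import Data.Sum.Base using (_⊎_; inj₁; inj₂)
open import Data.Vec.Base as Vec using ([]; _∷_; here; there)
import Data.Vec.Properties as Vec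
open import Function.Base using (_∘_; id)
open import Relation.Binary.Definitions using (DecidableEquality; tri<; tri≈; tri>)
open import Relation.Binary.PropositionalEquality as ≡ using (_≡_; _≢_)
open import Relation.Nullary using (¬_; Dec; yes; no; does; contradiction; ¬?)
open import Relation.Nullary.Decidable
  using (map′; recompute; dec⇒maybe; dec-true; dec-false; _×-dec_)
open import Relation.Unary using (Decidable; Pred)

-- Equality in `T` compares coefficients of formal sums with repetitions, so identities in `T` are
-- not proved by rearranging lists of terms. They are tested by functionals `eval h` with `h` valued
-- in a ring: coefficients are of this kind, so is the extension `φ`, and `eval h (x ∗̂ y)` is a
-- double evaluation of `product h`. The obstacle to associativity is the degree: the two
-- bracketings produce compositions of degree `p + q + r` and `p + (q + r)`, which are equal but not
-- by computation. Words carry no such index, and together with the number of blocks they determine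
-- the composition. It is therefore enough to use functionals that factor through `encode`, and no
-- transport occurs. Multiplicativity of `φ` depends on this associativity. A left factor `G ▷ Q` is
-- traded for `G ∗̂ Q` minus terms with fewer breaks, and in `(G ∗̂ Q) ∗̂ y` the generator has to be
-- moved outside, where multiplicativity is already known.

private
  variable
    n p q : ℕ

-- Coefficients of formal sums

coeff-++ : ∀ x y P → coeff (x ++ y) P ≡ coeff x P ℤ.+ coeff y P
coeff-++ []            y P = ≡.sym (ℤ.+-identityˡ _)
coeff-++ ((a , Q) ∷ x) y P =
  ≡.trans (≡.cong (ℤ._+_ c) (coeff-++ x y P)) (≡.sym (ℤ.+-assoc c (coeff x P) (coeff y P)))
  where c = if does (Q ≟ P) then a else 0ℤ

coeff-neg : ∀ x P → coeff (- x) P ≡ ℤ.- coeff x P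
coeff-neg []            P = ≡.refl
coeff-neg ((a , Q) ∷ x) P with Q ≟ P
... | yes _ = ≡.trans (≡.cong (ℤ._+_ (ℤ.- a)) (coeff-neg x P)) (≡.sym (ℤ.neg-distrib-+ a (coeff x P)))
... | no  _ = ≡.trans (≡.cong (ℤ._+_ 0ℤ) (coeff-neg x P)) (≡.sym (ℤ.neg-distrib-+ 0ℤ (coeff x P)))

-- A formal sum may list `P` several times; striking out all occurrences at once allows them to be
-- collected into a single coefficient.
remove : AllComp → T → T
remove P = filter (¬? ∘ (_≟ P) ∘ proj₂)

coeff-remove-≡ : ∀ P x → coeff (remove P x) P ≡ 0ℤ
coeff-remove-≡ P []            = ≡.refl
coeff-remove-≡ P ((a , Q) ∷ x) with Q ≟ P
... | yes _ = coeff-remove-≡ P x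
... | no Q≢P rewrite dec-false (Q ≟ P) Q≢P =
  ≡.trans (ℤ.+-identityˡ _) (coeff-remove-≡ P x)

coeff-remove-≢ : ∀ {P R} x → P ≢ R → coeff (remove P x) R ≡ coeff x R
coeff-remove-≢ []            P≢R = ≡.refl
coeff-remove-≢ {P} {R} ((a , Q) ∷ x) P≢R with Q ≟ P
... | yes ≡.refl rewrite dec-false (Q ≟ R) P≢R =
  ≡.trans (coeff-remove-≢ x P≢R) (≡.sym (ℤ.+-identityˡ _))
... | no _ = ≡.cong (ℤ._+_ (if does (Q ≟ R) then a else 0ℤ)) (coeff-remove-≢ x P≢R)

-- Linear functionals on formal sums

module Linear {c ℓ} (S : Ring c ℓ) where

  open Ring S renaming (-_ to neg; _≈_ to _≋_)
  open AbelianGroupProperties +-abelianGroup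
    using (inverseˡ-unique; identityʳ-unique; ⁻¹-∙-comm; ε⁻¹≈ε)
  open CommutativeSemigroupProperties +-commutativeSemigroup using (interchange; x∙yz≈y∙xz)
  open Mult semiring using () renaming (_×_ to _×ᴺ_)
  open import Relation.Binary.Reasoning.Setoid setoid

  infixr 7 _·_

  _·_ : ℤ → Carrier → Carrier
  + n      · s = n ×ᴺ s
  -[1+ n ] · s = neg (suc n ×ᴺ s)

  module _ (g : ℤ → Carrier) (g-+ : ∀ a b → g (a ℤ.+ b) ≋ g a + g b) where

    private
      g0 : g 0ℤ ≋ 0#
      g0 = identityʳ-unique (g 0ℤ) (g 0ℤ) (sym (g-+ 0ℤ 0ℤ))

      g+ : ∀ n → g (+ n) ≋ n ×ᴺ g 1ℤ
      g+ zero    = g0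
      g+ (suc n) = trans (g-+ 1ℤ (+ n)) (+-congˡ (g+ n))

    -- `ℤ` is generated by 1. Most laws of `·` below follow by checking that one side is additive in
    -- the scalar and comparing at `1ℤ`, which avoids case distinctions on signs.
    additive⇒· : ∀ a → g a ≋ a · g 1ℤ
    additive⇒· (+ n)      = g+ n
    additive⇒· -[1+ n ] = trans
      (inverseˡ-unique _ (g (+ suc n)) (begin
        g -[1+ n ] + g (+ suc n)  ≈⟨ g-+ -[1+ n ] (+ suc n) ⟨
        g (-[1+ n ] ℤ.+ + suc n)  ≡⟨ ≡.cong g (ℤ.+-inverseˡ (+ suc n)) ⟩
        g 0ℤ                      ≈⟨ g0 ⟩
        0#                        ∎))
      (-‿cong (g+ (suc n)))

  ·-congˡ : ∀ a {s t} → s ≋ t → a · s ≋ a · t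
  ·-congˡ (+ n)    s≋t = Mult.×-congʳ semiring n s≋t
  ·-congˡ -[1+ n ] s≋t = -‿cong (Mult.×-congʳ semiring (suc n) s≋t)

  ·-identityˡ : ∀ s → 1ℤ · s ≋ s
  ·-identityˡ = Mult.×-homo-1 semiring

  private
    -- Adding integers of opposite sign computes to `⊖`; the induction cancels one `s` against one
    -- `neg s`.
    ⊖-· : ∀ m n s → (m ℤ.⊖ n) · s ≋ m ×ᴺ s + neg (n ×ᴺ s)
    ⊖-· m       zero    s = sym (trans (+-congˡ ε⁻¹≈ε) (+-identityʳ _))
    ⊖-· zero    (suc n) s = sym (+-identityˡ _)
    ⊖-· (suc m) (suc n) s = begin
      (suc m ℤ.⊖ suc n) · s            ≡⟨ ≡.cong (_· s) (ℤ.[1+m]⊖[1+n]≡m⊖n m n) ⟩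
      (m ℤ.⊖ n) · s                    ≈⟨ ⊖-· m n s ⟩
      m ×ᴺ s + neg (n ×ᴺ s)              ≈⟨ +-identityˡ _ ⟨
      0# + (m ×ᴺ s + neg (n ×ᴺ s))       ≈⟨ +-congʳ (-‿inverseʳ s) ⟨
      (s + neg s) + (m ×ᴺ s + neg (n ×ᴺ s)) ≈⟨ interchange _ _ _ _ ⟩
      suc m ×ᴺ s + (neg s + neg (n ×ᴺ s)) ≈⟨ +-congˡ (⁻¹-∙-comm s (n ×ᴺ s)) ⟩
      suc m ×ᴺ s + neg (suc n ×ᴺ s)      ∎

  ·-distribʳ-+ : ∀ s a b → (a ℤ.+ b) · s ≋ a · s + b · s
  ·-distribʳ-+ s (+ m)    (+ n)    = Mult.×-homo-+ semiring s m n
  ·-distribʳ-+ s (+ m)    -[1+ n ] = ⊖-· m (suc n) s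
  ·-distribʳ-+ s -[1+ m ] (+ n)    = trans (⊖-· n (suc m) s) (+-comm _ _)
  ·-distribʳ-+ s -[1+ m ] -[1+ n ] = begin
    neg (suc (suc (m ℕ.+ n)) ×ᴺ s)     ≡⟨ ≡.cong (λ k → neg (suc k ×ᴺ s)) (≡.sym (ℕ.+-suc m n)) ⟩
    neg ((suc m ℕ.+ suc n) ×ᴺ s)       ≈⟨ -‿cong (Mult.×-homo-+ semiring s (suc m) (suc n)) ⟩
    neg (suc m ×ᴺ s + suc n ×ᴺ s)       ≈⟨ ⁻¹-∙-comm _ _ ⟨
    neg (suc m ×ᴺ s) + neg (suc n ×ᴺ s) ∎

  ·-distribˡ-+ : ∀ a s t → a · (s + t) ≋ a · s + a · t
  ·-distribˡ-+ a s t = sym (trans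
    (additive⇒· (λ a → a · s + a · t) (λ a b →
      trans (+-cong (·-distribʳ-+ s a b) (·-distribʳ-+ t a b)) (interchange _ _ _ _)) a)
    (·-congˡ a (+-cong (·-identityˡ s) (·-identityˡ t))))

  ·-zeroʳ : ∀ a → a · 0# ≋ 0#
  ·-zeroʳ a = sym (additive⇒· (λ _ → 0#) (λ _ _ → sym (+-identityˡ 0#)) a)

  ·-assoc : ∀ a b s → (a ℤ.* b) · s ≋ a · b · s
  ·-assoc a b s = trans
    (additive⇒· (λ a → (a ℤ.* b) · s)
      (λ a c → trans (reflexive (≡.cong (_· s) (ℤ.*-distribʳ-+ b a c))) (·-distribʳ-+ s (a ℤ.* b) (c ℤ.* b))) a)
    (·-congˡ a (reflexive (≡.cong (_· s) (ℤ.*-identityˡ b))))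

  ·-*-assoc : ∀ a s t → (a · s) * t ≋ a · (s * t)
  ·-*-assoc a s t = trans
    (additive⇒· (λ a → (a · s) * t)
      (λ a b → trans (*-congʳ (·-distribʳ-+ s a b)) (distribʳ _ _ _)) a)
    (·-congˡ a (*-congʳ (·-identityˡ s)))

  ·-*-comm : ∀ a s t → s * (a · t) ≋ a · (s * t)
  ·-*-comm a s t = trans
    (additive⇒· (λ a → s * (a · t))
      (λ a b → trans (*-congˡ (·-distribʳ-+ t a b)) (distribˡ _ _ _)) a)
    (·-congˡ a (*-congˡ (·-identityˡ t)))

  ·-neg : ∀ a s → (ℤ.- a) · s ≋ neg (a · s)
  ·-neg a s = inverseˡ-unique _ _ (trans (sym (·-distribʳ-+ s (ℤ.- a) a))
    (reflexive (≡.cong (_· s) (ℤ.+-inverseˡ a))))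

  ∑ : ∀ {x} {X : Set x} → List X → (X → Carrier) → Carrier
  ∑ []       h = 0#
  ∑ (x ∷ xs) h = h x + ∑ xs h

  ∑-cong : ∀ {x} {X : Set x} (xs : List X) {h k : X → Carrier} →
           (∀ x → h x ≋ k x) → ∑ xs h ≋ ∑ xs k
  ∑-cong []       h≋k = refl
  ∑-cong (x ∷ xs) h≋k = +-cong (h≋k x) (∑-cong xs h≋k)

  ∑-++ : ∀ {x} {X : Set x} (xs ys : List X) (h : X → Carrier) →
         ∑ (xs ++ ys) h ≋ ∑ xs h + ∑ ys h
  ∑-++ []       ys h = sym (+-identityˡ _)
  ∑-++ (x ∷ xs) ys h = trans (+-congˡ (∑-++ xs ys h)) (sym (+-assoc _ _ _))

  ∑-map : ∀ {x y} {X : Set x} {Y : Set y} (f : X → Y) (xs : List X) (h : Y → Carrier) →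
          ∑ (map f xs) h ≡ ∑ xs (h ∘ f)
  ∑-map f []       h = ≡.refl
  ∑-map f (x ∷ xs) h = ≡.cong₂ _+_ ≡.refl (∑-map f xs h)

  ∑-zero : ∀ {x} {X : Set x} (xs : List X) {h : X → Carrier} → (∀ x → h x ≋ 0#) → ∑ xs h ≋ 0#
  ∑-zero []       h≋0 = refl
  ∑-zero (x ∷ xs) h≋0 = trans (+-cong (h≋0 x) (∑-zero xs h≋0)) (+-identityˡ 0#)

  eval : (AllComp → Carrier) → T → Carrier
  eval h x = ∑ x λ (a , P) → a · h P

  eval-cong : ∀ {h k} → (∀ P → h P ≋ k P) → ∀ x → eval h x ≋ eval k x
  eval-cong h≋k x = ∑-cong x λ (a , P) → ·-congˡ a (h≋k P)

  eval-++ : ∀ h x y → eval h (x ++ y) ≋ eval h x + eval h y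
  eval-++ h x y = ∑-++ x y _

  eval-neg : ∀ h x → eval h (- x) ≋ neg (eval h x)
  eval-neg h []            = sym ε⁻¹≈ε
  eval-neg h ((a , P) ∷ x) = trans (+-cong (·-neg a (h P)) (eval-neg h x)) (⁻¹-∙-comm _ _)

  eval-⟨⟩ : ∀ h P → eval h ⟨ P ⟩ ≋ h P
  eval-⟨⟩ h P = trans (+-identityʳ _) (·-identityˡ (h P))

  eval-+ : ∀ h k x → eval (λ P → h P + k P) x ≋ eval h x + eval k x
  eval-+ h k []            = sym (+-identityˡ 0#)
  eval-+ h k ((a , P) ∷ x) =
    trans (+-cong (·-distribˡ-+ a (h P) (k P)) (eval-+ h k x)) (interchange _ _ _ _)

  eval-0 : ∀ x → eval (λ _ → 0#) x ≋ 0#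
  eval-0 x = ∑-zero x λ (a , _) → ·-zeroʳ a

  eval-∑ : ∀ {x} {X : Set x} (xs : List X) (h : X → AllComp → Carrier) y →
           eval (λ P → ∑ xs λ x → h x P) y ≋ ∑ xs λ x → eval (h x) y
  eval-∑ []       h y = eval-0 y
  eval-∑ (x ∷ xs) h y = trans (eval-+ _ _ y) (+-congˡ (eval-∑ xs h y))

  eval-*ˡ : ∀ s h x → eval (λ P → s * h P) x ≋ s * eval h x
  eval-*ˡ s h []            = sym (zeroʳ s)
  eval-*ˡ s h ((a , P) ∷ x) =
    trans (+-cong (sym (·-*-comm a s (h P))) (eval-*ˡ s h x)) (sym (distribˡ _ _ _))

  eval-*ʳ : ∀ s h x → eval (λ P → h P * s) x ≋ eval h x * s
  eval-*ʳ s h []            = sym (zeroˡ s)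
  eval-*ʳ s h ((a , P) ∷ x) =
    trans (+-cong (sym (·-*-assoc a (h P) s)) (eval-*ʳ s h x)) (sym (distribʳ _ _ _))

  eval-· : ∀ a h x → eval (λ P → a · h P) x ≋ a · eval h x
  eval-· a h []            = sym (·-zeroʳ a)
  eval-· a h ((b , P) ∷ x) = begin
    b · a · h P + eval (λ P → a · h P) x ≈⟨ +-cong (sym (·-assoc b a (h P))) (eval-· a h x) ⟩
    (b ℤ.* a) · h P + a · eval h x       ≡⟨ ≡.cong (λ c → c · h P + a · eval h x) (ℤ.*-comm b a) ⟩
    (a ℤ.* b) · h P + a · eval h x       ≈⟨ +-congʳ (·-assoc a b (h P)) ⟩
    a · b · h P + a · eval h x           ≈⟨ ·-distribˡ-+ a _ _ ⟨
    a · (b · h P + eval h x)             ∎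

  eval-remove : ∀ h P x → eval h x ≋ coeff x P · h P + eval h (remove P x)
  eval-remove h P []            = sym (+-identityˡ 0#)
  eval-remove h P ((a , Q) ∷ x) with Q ≟ P
  ... | yes ≡.refl = begin
    a · h P + eval h x                                        ≈⟨ +-congˡ (eval-remove h P x) ⟩
    a · h P + (coeff x P · h P + eval h (remove P x))         ≈⟨ +-assoc _ _ _ ⟨
    a · h P + coeff x P · h P + eval h (remove P x)           ≈⟨ +-congʳ (·-distribʳ-+ (h P) a (coeff x P)) ⟨
    (a ℤ.+ coeff x P) · h P + eval h (remove P x)             ∎
  ... | no _ = begin
    a · h Q + eval h x                                        ≈⟨ +-congˡ (eval-remove h P x) ⟩
    a · h Q + (coeff x P · h P + eval h (remove P x))         ≈⟨ x∙yz≈y∙xz _ _ _ ⟩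
    coeff x P · h P + (a · h Q + eval h (remove P x))
      ≡⟨ ≡.cong (λ b → b · h P + (a · h Q + eval h (remove P x))) (≡.sym (ℤ.+-identityˡ (coeff x P))) ⟩
    (0ℤ ℤ.+ coeff x P) · h P + (a · h Q + eval h (remove P x)) ∎

  private
    -- The occurrences of the head composition contribute its total coefficient, which is zero, and
    -- striking them out leaves a shorter null sum. That sum is a filtered tail, hence the recursion
    -- on a bound for the length.
    eval-null′ : ∀ h n x → length x ℕ.≤ n → x ≈ [] → eval h x ≋ 0#
    eval-null′ h n       []              _  x≈0 = refl
    eval-null′ h (suc n) x@((a , P) ∷ y) (ℕ.s≤s y≤n) x≈0 = begin
      eval h x                               ≈⟨ eval-remove h P x ⟩
      coeff x P · h P + eval h (remove P x)  ≈⟨ +-cong (reflexive (≡.cong (_· h P) (x≈0 P)))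
                                                  (reflexive (≡.cong (eval h) remove-head)) ⟩
      0# + eval h (remove P y)               ≈⟨ +-identityˡ _ ⟩
      eval h (remove P y)                    ≈⟨ eval-null′ h n (remove P y)
                                                  (ℕ.≤-trans (List.length-filter _ y) y≤n) removed≈0 ⟩
      0#                                     ∎
      where
      remove-head : remove P x ≡ remove P y
      remove-head rewrite dec-true (P ≟ P) ≡.refl = ≡.refl
      removed≈0 : remove P y ≈ []
      removed≈0 R with P ≟ R
      ... | yes ≡.refl = coeff-remove-≡ P y
      ... | no P≢R = ≡.trans (≡.cong (λ z → coeff z R) (≡.sym remove-head))
                             (≡.trans (coeff-remove-≢ x P≢R) (x≈0 R))

  -- Well-definedness on the quotient: by additivity only the null sum `x ++ - y` has to be
  -- considered.
  eval-resp-≈ : ∀ h {x y} → x ≈ y → eval h x ≋ eval h y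
  eval-resp-≈ h {x} {y} x≈y = begin
    eval h x                                    ≈⟨ +-identityʳ _ ⟨
    eval h x + 0#                               ≈⟨ +-congˡ (-‿inverseˡ _) ⟨
    eval h x + (neg (eval h y) + eval h y)      ≈⟨ +-assoc _ _ _ ⟨
    eval h x + neg (eval h y) + eval h y        ≈⟨ +-congʳ (+-congˡ (eval-neg h y)) ⟨
    eval h x + eval h (- y) + eval h y          ≈⟨ +-congʳ (eval-++ h x (- y)) ⟨
    eval h (x ++ - y) + eval h y                ≈⟨ +-congʳ (eval-null′ h _ (x ++ - y) ℕ.≤-refl difference) ⟩
    0# + eval h y                               ≈⟨ +-identityˡ _ ⟩
    eval h y                                    ∎
    where
    difference : (x ++ - y) ≈ []
    difference P = ≡.trans (coeff-++ x (- y) P) (≡.trans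
      (≡.cong₂ ℤ._+_ (x≈y P) (coeff-neg y P)) (ℤ.+-inverseʳ (coeff y P)))

  -- The functional `h` applied to the product of two basis elements. With `h` arbitrary, iterated
  -- products are expressed by feeding one `product` into another as its functional.
  product : (AllComp → Carrier) → AllComp → AllComp → Carrier
  product h (p , P) (q , Q) = ∑ (terms P Q) λ R → h (p ℕ.+ q , R)

  product-cong : ∀ {h k} → (∀ P → h P ≋ k P) → ∀ P Q → product h P Q ≋ product k P Q
  product-cong h≋k (p , P) (q , Q) = ∑-cong (terms P Q) λ R → h≋k _

  private
    ∑-concatMap : ∀ {x y} {X : Set x} {Y : Set y} (f : X → List Y) xs (h : Y → Carrier) →
                  ∑ (concatMap f xs) h ≋ ∑ xs λ x → ∑ (f x) h
    ∑-concatMap f []       h = refl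
    ∑-concatMap f (x ∷ xs) h = trans (∑-++ (f x) _ h) (+-congˡ (∑-concatMap f xs h))

    ∑-· : ∀ {x} {X : Set x} a (xs : List X) (h : X → Carrier) →
          (∑ xs λ x → a · h x) ≋ a · ∑ xs h
    ∑-· a []       h = sym (·-zeroʳ a)
    ∑-· a (x ∷ xs) h = trans (+-congˡ (∑-· a xs h)) (sym (·-distribˡ-+ a _ _))

  eval-∗̂ : ∀ h x y → eval h (x ∗̂ y) ≋ eval (λ P → eval (λ Q → product h P Q) y) x
  eval-∗̂ h x y = trans (∑-concatMap _ x _) (∑-cong x λ (a , (p , P)) → begin
    _ ≈⟨ ∑-concatMap _ y _ ⟩
    _ ≈⟨ ∑-cong y (λ (b , (q , Q)) → begin
           _ ≡⟨ ∑-map _ (terms P Q) _ ⟩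
           _ ≈⟨ ∑-· (a ℤ.* b) (terms P Q) _ ⟩
           _ ≈⟨ ·-assoc a b _ ⟩
           _ ∎) ⟩
    _ ≈⟨ ∑-· a y _ ⟩
    _ ∎)

-- Set compositions as words of columns

-- relabel without the constraint p = ∣ A ∣ in the type, so that no transport is needed; only
-- meaningful if it holds (otherwise X is truncated or padded with outside).
relab : Subset n → Subset p → Subset n
relab []            X       = []
relab (outside ∷ A) X       = outside ∷ relab A X
relab (inside  ∷ A) []      = outside ∷ relab A []
relab (inside  ∷ A) (x ∷ X) = x ∷ relab A X

relabel≡relab : (A : Subset n) (X : Subset ∣ A ∣) → relabel A X ≡ relab A X
relabel≡relab []            X       = ≡.refl
relabel≡relab (outside ∷ A) X       = ≡.cong (outside ∷_) (relabel≡relab A X)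
relabel≡relab (inside  ∷ A) (x ∷ X) = ≡.cong (x ∷_) (relabel≡relab A X)

blocks-is : (A : Subset n) (e : ∣ A ∣ ≡ p) (P : Comp p) →
            blocks (is A e P) ≡ map (relab A) (blocks P)
blocks-is A ≡.refl P = List.map-cong (relabel≡relab A) (blocks P)

-- Repeats the local function inside `terms`, so that `terms P Q` is by computation `termsOver P Q`
-- of all subsets; the list of subsets becomes a parameter in order to be split later.
term : Comp p → Comp q → (A : Subset (p ℕ.+ q)) → ∣ A ∣ ≡ p → Comp (p ℕ.+ q)
term {p} {q} P Q A e = concatenate (#-∁ A) (p∪∁p≡⊤ A) (is A e P) (is (∁ A) (∣∁A∣≡q {p} {q} A e) Q)

termsOver : Comp p → Comp q → List (Subset (p ℕ.+ q)) → List (Comp (p ℕ.+ q))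
termsOver {p} P Q = mapMaybe (λ A → Maybe.map (term P Q A) (dec⇒maybe (∣ A ∣ ℕ.≟ p)))

blocks-term : (P : Comp p) (Q : Comp q) (A : Subset (p ℕ.+ q)) (e : ∣ A ∣ ≡ p) →
              blocks (term P Q A e) ≡ map (relab A) (blocks P) ++ map (relab (∁ A)) (blocks Q)
blocks-term {p} {q} P Q A e =
  ≡.cong₂ _++_ (blocks-is A e P) (blocks-is (∁ A) (∣∁A∣≡q {p} {q} A e) Q)

AllComp-≡ : {P Q : Comp n} → blocks P ≡ blocks Q → _≡_ {A = AllComp} (n , P) (n , Q)
AllComp-≡ {P = setComposition _ _} {setComposition _ _} ≡.refl = ≡.refl

Word : Set
Word = List (List Bool)

columns : List (Subset n) → Word
columns {zero}  Ps = []
columns {suc n} Ps = map Vec.head Ps ∷ columns (map Vec.tail Ps)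

-- For n = 0 the columns do not determine the number of blocks.
encode : AllComp → ℕ × Word
encode (n , P) = length (blocks P) , columns (blocks P)

length-columns : (Ps : List (Subset n)) → length (columns Ps) ≡ n
length-columns {zero}  Ps = ≡.refl
length-columns {suc n} Ps = ≡.cong suc (length-columns (map Vec.tail Ps))

columns-injective : (Ps Qs : List (Subset n)) → length Ps ≡ length Qs →
                    columns Ps ≡ columns Qs → Ps ≡ Qs
columns-injective {zero} []        []        _ _ = ≡.refl
columns-injective {zero} ([] ∷ Ps) ([] ∷ Qs) l _ =
  ≡.cong ([] ∷_) (columns-injective Ps Qs (ℕ.suc-injective l) ≡.refl)
columns-injective {suc n} Ps Qs l c = head-tail Ps Qs (List.∷-injectiveˡ c)
  (columns-injective (map Vec.tail Ps) (map Vec.tail Qs)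
    (≡.trans (List.length-map _ Ps) (≡.trans l (≡.sym (List.length-map _ Qs))))
    (List.∷-injectiveʳ c))
  where
  head-tail : (Ps Qs : List (Subset (suc n))) → map Vec.head Ps ≡ map Vec.head Qs →
              map Vec.tail Ps ≡ map Vec.tail Qs → Ps ≡ Qs
  head-tail []             []             _ _ = ≡.refl
  head-tail ((x ∷ X) ∷ Ps) ((y ∷ Y) ∷ Qs) h t = ≡.cong₂ _∷_
    (≡.cong₂ _∷_ (List.∷-injectiveˡ h) (List.∷-injectiveˡ t))
    (head-tail Ps Qs (List.∷-injectiveʳ h) (List.∷-injectiveʳ t))

encode-injective : ∀ P Q → encode P ≡ encode Q → P ≡ Q
encode-injective (m , P) (n , Q) e
  with ≡.trans (≡.sym (length-columns (blocks P)))
         (≡.trans (≡.cong (length ∘ proj₂) e) (length-columns (blocks Q)))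
... | ≡.refl = AllComp-≡
  (columns-injective (blocks P) (blocks Q) (≡.cong proj₁ e) (≡.cong proj₂ e))

padʳ padˡ : ℕ → List Bool → List Bool
padʳ l c = c ++ replicate l outside
padˡ k c = replicate k outside ++ c

-- `A` marks the positions that receive the letters of the first word. The last clause ends the
-- recursion at `A = []`; it also truncates when a word runs out too early.
interleave : ∀ {x} {X : Set x} → Subset n → List X → List X → List X
interleave (inside  ∷ A) (x ∷ u) v       = x ∷ interleave A u v
interleave (outside ∷ A) u       (y ∷ v) = y ∷ interleave A u v
interleave _             _       _       = []

private
  map-const : ∀ {x y} {X : Set x} {Y : Set y} (c : Y) (xs : List X) →
              map (λ _ → c) xs ≡ replicate (length xs) c
  map-const c []       = ≡.refl
  map-const c (x ∷ xs) = ≡.cong (c ∷_) (map-const c xs)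

  replicate-+ : ∀ {x} {X : Set x} i j {c : X} → replicate (i ℕ.+ j) c ≡ replicate i c ++ replicate j c
  replicate-+ zero    j = ≡.refl
  replicate-+ (suc i) j = ≡.cong (_ ∷_) (replicate-+ i j)

-- An element of `A` lies in no block that comes from `Qs`, so its column is one of `Ps` followed by
-- zeros; an element of `∁ A` has the zeros in front. Since relabelling preserves order, the columns
-- of each factor keep their order.
columns-relab : (A : Subset n) (Ps : List (Subset p)) (Qs : List (Subset q)) →
  ∣ A ∣ ≡ p → ∣ ∁ A ∣ ≡ q →
  columns (map (relab A) Ps ++ map (relab (∁ A)) Qs) ≡
  interleave A (map (padʳ (length Qs)) (columns Ps)) (map (padˡ (length Ps)) (columns Qs))
columns-relab []            Ps Qs e e′ = ≡.refl
columns-relab (inside ∷ A) Ps Qs ≡.refl e′ = ≡.cong₂ _∷_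
  (begin
    map Vec.head (map (relab (inside ∷ A)) Ps ++ map (relab (outside ∷ ∁ A)) Qs)
      ≡⟨ List.map-++ Vec.head (map _ Ps) (map _ Qs) ⟩
    map Vec.head (map (relab (inside ∷ A)) Ps) ++ map Vec.head (map (relab (outside ∷ ∁ A)) Qs)
      ≡⟨ ≡.cong₂ _++_ (List.map-∘ Ps) (List.map-∘ Qs) ⟨
    map (Vec.head ∘ relab (inside ∷ A)) Ps ++ map (λ _ → outside) Qs
      ≡⟨ ≡.cong₂ _++_ (List.map-cong (λ { (x ∷ X) → ≡.refl }) Ps) (map-const outside Qs) ⟩
    map Vec.head Ps ++ replicate (length Qs) outside ∎)
  (begin
    columns (map Vec.tail (map (relab (inside ∷ A)) Ps ++ map (relab (outside ∷ ∁ A)) Qs))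
      ≡⟨ ≡.cong columns (List.map-++ Vec.tail (map _ Ps) (map _ Qs)) ⟩
    columns (map Vec.tail (map (relab (inside ∷ A)) Ps) ++ map Vec.tail (map (relab (outside ∷ ∁ A)) Qs))
      ≡⟨ ≡.cong columns (≡.cong₂ _++_ (List.map-∘ Ps) (List.map-∘ Qs)) ⟨
    columns (map (Vec.tail ∘ relab (inside ∷ A)) Ps ++ map (relab (∁ A)) Qs)
      ≡⟨ ≡.cong (λ Rs → columns (Rs ++ map (relab (∁ A)) Qs)) (≡.trans
           (List.map-cong (λ { (x ∷ X) → ≡.refl }) Ps) (List.map-∘ Ps)) ⟩
    columns (map (relab A) (map Vec.tail Ps) ++ map (relab (∁ A)) Qs)
      ≡⟨ columns-relab A (map Vec.tail Ps) Qs ≡.refl e′ ⟩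
    interleave A (map (padʳ (length Qs)) (columns (map Vec.tail Ps)))
                 (map (padˡ (length (map Vec.tail Ps))) (columns Qs))
      ≡⟨ ≡.cong (λ k → interleave A (map (padʳ (length Qs)) (columns (map Vec.tail Ps)))
                                   (map (padˡ k) (columns Qs))) (List.length-map _ Ps) ⟩
    interleave A (map (padʳ (length Qs)) (columns (map Vec.tail Ps)))
                 (map (padˡ (length Ps)) (columns Qs)) ∎)
  where open ≡.≡-Reasoning
columns-relab (outside ∷ A) Ps Qs e ≡.refl = ≡.cong₂ _∷_
  (begin
    map Vec.head (map (relab (outside ∷ A)) Ps ++ map (relab (inside ∷ ∁ A)) Qs)
      ≡⟨ List.map-++ Vec.head (map _ Ps) (map _ Qs) ⟩
    map Vec.head (map (relab (outside ∷ A)) Ps) ++ map Vec.head (map (relab (inside ∷ ∁ A)) Qs)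
      ≡⟨ ≡.cong₂ _++_ (List.map-∘ Ps) (List.map-∘ Qs) ⟨
    map (λ _ → outside) Ps ++ map (Vec.head ∘ relab (inside ∷ ∁ A)) Qs
      ≡⟨ ≡.cong₂ _++_ (map-const outside Ps) (List.map-cong (λ { (x ∷ X) → ≡.refl }) Qs) ⟩
    replicate (length Ps) outside ++ map Vec.head Qs ∎)
  (begin
    columns (map Vec.tail (map (relab (outside ∷ A)) Ps ++ map (relab (inside ∷ ∁ A)) Qs))
      ≡⟨ ≡.cong columns (List.map-++ Vec.tail (map _ Ps) (map _ Qs)) ⟩
    columns (map Vec.tail (map (relab (outside ∷ A)) Ps) ++ map Vec.tail (map (relab (inside ∷ ∁ A)) Qs))
      ≡⟨ ≡.cong columns (≡.cong₂ _++_ (List.map-∘ Ps) (List.map-∘ Qs)) ⟨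
    columns (map (relab A) Ps ++ map (Vec.tail ∘ relab (inside ∷ ∁ A)) Qs)
      ≡⟨ ≡.cong (λ Rs → columns (map (relab A) Ps ++ Rs)) (≡.trans
           (List.map-cong (λ { (x ∷ X) → ≡.refl }) Qs) (List.map-∘ Qs)) ⟩
    columns (map (relab A) Ps ++ map (relab (∁ A)) (map Vec.tail Qs))
      ≡⟨ columns-relab A Ps (map Vec.tail Qs) e ≡.refl ⟩
    interleave A (map (padʳ (length (map Vec.tail Qs))) (columns Ps))
                 (map (padˡ (length Ps)) (columns (map Vec.tail Qs)))
      ≡⟨ ≡.cong (λ l → interleave A (map (padʳ l) (columns Ps))
                                   (map (padˡ (length Ps)) (columns (map Vec.tail Qs)))) (List.length-map _ Qs) ⟩
    interleave A (map (padʳ (length Qs)) (columns Ps))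
                 (map (padˡ (length Ps)) (columns (map Vec.tail Qs))) ∎)
  where open ≡.≡-Reasoning

-- The product as a shuffle of words

module Shuffle {c ℓ} (S : Ring c ℓ) where

  open Ring S renaming (-_ to neg; _≈_ to _≋_)
  open CommutativeSemigroupProperties +-commutativeSemigroup using (interchange)
  open Linear S
  open import Relation.Binary.Reasoning.Setoid setoid

  -- The shuffles of two words are summed through the continuation `h` and never listed, so their
  -- order of enumeration does not matter.
  ∑⧢ : ∀ {x} {X : Set x} → List X → List X → (List X → Carrier) → Carrier
  ∑⧢ []      v       h = h v
  ∑⧢ (x ∷ u) []      h = h (x ∷ u)
  ∑⧢ (x ∷ u) (y ∷ v) h = ∑⧢ u (y ∷ v) (h ∘ (x ∷_)) + ∑⧢ (x ∷ u) v (h ∘ (y ∷_))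

  -- Needed once the second word is used up: the subsets that omit the next position can no longer
  -- reach the required size.
  ∑-subsets-> : ∀ n p (h : Subset n → Carrier) → n ℕ.< p →
                ∑ (subsets n) (λ A → if does (∣ A ∣ ℕ.≟ p) then h A else 0#) ≋ 0#
  ∑-subsets-> n p h n<p = ∑-zero (subsets n) vanish
    where
    vanish : ∀ A → (if does (∣ A ∣ ℕ.≟ p) then h A else 0#) ≋ 0#
    vanish A rewrite dec-false (∣ A ∣ ℕ.≟ p)
      (λ e → ℕ.<⇒≱ n<p (≡.subst (ℕ._≤ n) e (∣p∣≤n A))) = refl

  module _ {x} {X : Set x} where

    ∑⧢-identityʳ : ∀ (u : List X) h → ∑⧢ u [] h ≡ h u
    ∑⧢-identityʳ []      h = ≡.refl
    ∑⧢-identityʳ (x ∷ u) h = ≡.refl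

    ∑⧢-cong : ∀ (u v : List X) {h k} → (∀ w → h w ≋ k w) → ∑⧢ u v h ≋ ∑⧢ u v k
    ∑⧢-cong []      v       h≋k = h≋k v
    ∑⧢-cong (x ∷ u) []      h≋k = h≋k (x ∷ u)
    ∑⧢-cong (x ∷ u) (y ∷ v) h≋k =
      +-cong (∑⧢-cong u (y ∷ v) (h≋k ∘ (x ∷_))) (∑⧢-cong (x ∷ u) v (h≋k ∘ (y ∷_)))

    ∑⧢-+ : ∀ (u v : List X) h k → ∑⧢ u v (λ w → h w + k w) ≋ ∑⧢ u v h + ∑⧢ u v k
    ∑⧢-+ []      v       h k = refl
    ∑⧢-+ (x ∷ u) []      h k = refl
    ∑⧢-+ (x ∷ u) (y ∷ v) h k =
      trans (+-cong (∑⧢-+ u (y ∷ v) _ _) (∑⧢-+ (x ∷ u) v _ _)) (interchange _ _ _ _)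

    -- The first letter of a shuffle of three words comes from `u`, `v` or `w`. Both sides are
    -- sorted by this choice, and each of the three groups is an instance of the induction
    -- hypothesis.
    ∑⧢-assoc : ∀ (u v w : List X) h →
               ∑⧢ u v (λ t → ∑⧢ t w h) ≋ ∑⧢ v w (λ t → ∑⧢ u t h)
    ∑⧢-assoc []      v       w       h = refl
    ∑⧢-assoc (x ∷ u) []      w       h = refl
    ∑⧢-assoc (x ∷ u) (y ∷ v) []      h = ∑⧢-cong (x ∷ u) (y ∷ v) λ t → reflexive (∑⧢-identityʳ t h)
    ∑⧢-assoc xu@(x ∷ u) yv@(y ∷ v) zw@(z ∷ w) h = begin
      ∑⧢ u yv (λ t → ∑⧢ t zw hx + ∑⧢ (x ∷ t) w hz) + ∑⧢ xu v (λ t → ∑⧢ t zw hy + ∑⧢ (y ∷ t) w hz)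
        ≈⟨ +-cong (∑⧢-+ u yv _ _) (∑⧢-+ xu v _ _) ⟩
      (∑⧢ u yv (λ t → ∑⧢ t zw hx) + _) + (∑⧢ xu v (λ t → ∑⧢ t zw hy) + _)
        ≈⟨ interchange _ _ _ _ ⟩
      -- The two sums with first letter `z` fold, by the definition of `∑⧢`, into one sum over the
      -- shuffles of `xu` and `yv`. On the other side the same happens to the two sums with first
      -- letter `x`.
      (∑⧢ u yv (λ t → ∑⧢ t zw hx) + ∑⧢ xu v (λ t → ∑⧢ t zw hy)) + ∑⧢ xu yv (λ t → ∑⧢ t w hz)
        ≈⟨ +-cong (+-cong (∑⧢-assoc u yv zw hx) (∑⧢-assoc xu v zw hy)) (∑⧢-assoc xu yv w hz) ⟩
      ((∑⧢ v zw (λ t → ∑⧢ u (y ∷ t) hx) + ∑⧢ yv w (λ t → ∑⧢ u (z ∷ t) hx)) +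
        ∑⧢ v zw (λ t → ∑⧢ xu t hy)) + ∑⧢ yv w (λ t → ∑⧢ xu t hz)
        ≈⟨ +-assoc _ _ _ ⟩
      (∑⧢ v zw (λ t → ∑⧢ u (y ∷ t) hx) + ∑⧢ yv w (λ t → ∑⧢ u (z ∷ t) hx)) +
        (∑⧢ v zw (λ t → ∑⧢ xu t hy) + ∑⧢ yv w (λ t → ∑⧢ xu t hz))
        ≈⟨ interchange _ _ _ _ ⟩
      (∑⧢ v zw (λ t → ∑⧢ u (y ∷ t) hx) + ∑⧢ v zw (λ t → ∑⧢ xu t hy)) +
        (∑⧢ yv w (λ t → ∑⧢ u (z ∷ t) hx) + ∑⧢ yv w (λ t → ∑⧢ xu t hz))
        ≈⟨ +-cong (∑⧢-+ v zw _ _) (∑⧢-+ yv w _ _) ⟨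
      ∑⧢ v zw (λ t → ∑⧢ u (y ∷ t) hx + ∑⧢ xu t hy) + ∑⧢ yv w (λ t → ∑⧢ u (z ∷ t) hx + ∑⧢ xu t hz) ∎
      where
      hx = h ∘ (x ∷_)
      hy = h ∘ (y ∷_)
      hz = h ∘ (z ∷_)

    ∑⧢-map : ∀ {y} {Y : Set y} (f : X → Y) u v h →
             ∑⧢ (map f u) (map f v) h ≡ ∑⧢ u v (h ∘ map f)
    ∑⧢-map f []      v       h = ≡.refl
    ∑⧢-map f (x ∷ u) []      h = ≡.refl
    ∑⧢-map f (x ∷ u) (y ∷ v) h = ≡.cong₂ _+_ (∑⧢-map f u (y ∷ v) _) (∑⧢-map f (x ∷ u) v _)

    -- Whether the first position belongs to `A` decides which word supplies the first letter, so
    -- the recursion of `subsets` matches that of `∑⧢`.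
    ∑-interleave : ∀ n (u v : List X) h → length u ℕ.+ length v ≡ n →
      ∑ (subsets n) (λ A → if does (∣ A ∣ ℕ.≟ length u) then h (interleave A u v) else 0#) ≋
      ∑⧢ u v h
    ∑-interleave zero    []      []      h e = +-identityʳ _
    ∑-interleave (suc n) []      (y ∷ v) h e = begin
      _ ≈⟨ ∑-++ (map (inside ∷_) (subsets n)) _ _ ⟩
      _ ≡⟨ ≡.cong₂ _+_ (∑-map _ (subsets n) _) (∑-map _ (subsets n) _) ⟩
      -- With the first word empty the required size is 0, so the test fails by computation for
      -- every subset that contains the first position.
      _ ≈⟨ +-cong (∑-zero (subsets n) λ _ → refl) (∑-interleave n [] v (h ∘ (y ∷_)) (ℕ.suc-injective e)) ⟩
      _ ≈⟨ +-identityˡ _ ⟩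
      _ ∎
    ∑-interleave (suc n) (x ∷ u) []      h e = begin
      _ ≈⟨ ∑-++ (map (inside ∷_) (subsets n)) _ _ ⟩
      _ ≡⟨ ≡.cong₂ _+_ (∑-map _ (subsets n) _) (∑-map _ (subsets n) _) ⟩
      _ ≈⟨ +-cong (∑-interleave n u [] (h ∘ (x ∷_)) (ℕ.suc-injective e))
                  (∑-subsets-> n (suc (length u)) _ (ℕ.≤-reflexive (≡.cong suc
                    (≡.trans (≡.sym (ℕ.suc-injective e)) (ℕ.+-identityʳ _))))) ⟩
      _ ≈⟨ +-identityʳ _ ⟩
      _ ≡⟨ ∑⧢-identityʳ u _ ⟩
      _ ∎
    ∑-interleave (suc n) (x ∷ u) (y ∷ v) h e = begin
      _ ≈⟨ ∑-++ (map (inside ∷_) (subsets n)) _ _ ⟩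
      _ ≡⟨ ≡.cong₂ _+_ (∑-map _ (subsets n) _) (∑-map _ (subsets n) _) ⟩
      _ ≈⟨ +-cong (∑-interleave n u (y ∷ v) _ (ℕ.suc-injective e))
                  (∑-interleave n (x ∷ u) v _ (ℕ.suc-injective
                    (≡.trans (≡.cong suc (≡.sym (ℕ.+-suc (length u) (length v)))) e))) ⟩
      _ ∎

  ∑-mapMaybe : ∀ {x y d} {X : Set x} {Y : Set y} {D : X → Set d} (D? : ∀ x → Dec (D x))
               (f : ∀ x → D x → Y) (h : Y → Carrier) (k : X → Carrier) →
               (∀ x d → h (f x d) ≡ k x) → ∀ xs →
               ∑ (mapMaybe (λ x → Maybe.map (f x) (dec⇒maybe (D? x))) xs) h ≋
               ∑ xs (λ x → if does (D? x) then k x else 0#)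
  ∑-mapMaybe D? f h k h≡k []       = refl
  ∑-mapMaybe D? f h k h≡k (x ∷ xs) with D? x
  ... | yes d = +-cong (reflexive (h≡k x d)) (∑-mapMaybe D? f h k h≡k xs)
  ... | no  _ = trans (∑-mapMaybe D? f h k h≡k xs) (sym (+-identityˡ _))

  -- The right-hand side depends only on the two codes, so the degrees and the validity proofs
  -- disappear from all further computations.
  product-encode : ∀ (h : ℕ × Word → Carrier) P Q →
    let (k , u) = encode P
        (l , v) = encode Q
    in product (h ∘ encode) P Q ≋ ∑⧢ (map (padʳ l) u) (map (padˡ k) v) (λ w → h (k ℕ.+ l , w))
  product-encode h (p , P) (q , Q) = begin
    product (h ∘ encode) (p , P) (q , Q)
      ≈⟨ ∑-mapMaybe (λ A → ∣ A ∣ ℕ.≟ p) (term P Q) _ (λ A → h (k ℕ.+ l , interleave A u v))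
           encode-term (subsets (p ℕ.+ q)) ⟩
    ∑ (subsets (p ℕ.+ q)) (λ A → if does (∣ A ∣ ℕ.≟ p) then h (k ℕ.+ l , interleave A u v) else 0#)
      -- The size test has to refer to the length of the word, not to the degree, before
      -- `∑-interleave` applies.
      ≡⟨ ≡.cong (λ p′ → ∑ (subsets (p ℕ.+ q)) (λ A → if does (∣ A ∣ ℕ.≟ p′)
           then h (k ℕ.+ l , interleave A u v) else 0#)) length-u ⟨
    ∑ (subsets (p ℕ.+ q)) (λ A → if does (∣ A ∣ ℕ.≟ length u) then h (k ℕ.+ l , interleave A u v) else 0#)
      ≈⟨ ∑-interleave (p ℕ.+ q) u v _ (≡.cong₂ ℕ._+_ length-u length-v) ⟩
    ∑⧢ u v (λ w → h (k ℕ.+ l , w)) ∎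
    where
    k = length (blocks P)
    l = length (blocks Q)
    u = map (padʳ l) (columns (blocks P))
    v = map (padˡ k) (columns (blocks Q))
    length-u : length u ≡ p
    length-u = ≡.trans (List.length-map _ (columns (blocks P))) (length-columns (blocks P))
    length-v : length v ≡ q
    length-v = ≡.trans (List.length-map _ (columns (blocks Q))) (length-columns (blocks Q))
    encode-term : ∀ A e → h (encode (p ℕ.+ q , term P Q A e)) ≡ h (k ℕ.+ l , interleave A u v)
    encode-term A e rewrite blocks-term P Q A e = ≡.cong h (≡.cong₂ _,_
      (≡.trans (List.length-++ (map (relab A) (blocks P)))
        (≡.cong₂ ℕ._+_ (List.length-map _ (blocks P)) (List.length-map _ (blocks Q))))
      (columns-relab A (blocks P) (blocks Q) e (∣∁A∣≡q {p} {q} A e)))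

  product-identityˡ : ∀ (h : ℕ × Word → Carrier) Q → product (h ∘ encode) ∅ Q ≋ h (encode Q)
  product-identityˡ h Q = trans (product-encode h ∅ Q)
    (reflexive (≡.cong (λ w → h (proj₁ (encode Q) , w)) (List.map-id (proj₂ (encode Q)))))

  product-identityʳ : ∀ (h : ℕ × Word → Carrier) P → product (h ∘ encode) P ∅ ≋ h (encode P)
  product-identityʳ h P = trans (product-encode h P ∅) (trans (reflexive (∑⧢-identityʳ (map (padʳ 0) (proj₂ (encode P))) _))
    (reflexive (≡.cong₂ (λ k w → h (k , w)) (ℕ.+-identityʳ _)
      (≡.trans (List.map-cong List.++-identityʳ (proj₂ (encode P))) (List.map-id (proj₂ (encode P)))))))

  -- Both bracketings shuffle the same three padded words: `u` with `l + m` zeros behind, `v` with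
  -- `k` in front and `m` behind, `w` with `k + l` in front. The inner products are rewritten as the
  -- functionals `hR` and `hP` on codes, so that `product-encode` applies a second time.
  product-assoc : ∀ (h : ℕ × Word → Carrier) P Q R →
    product (λ X → product (h ∘ encode) X R) P Q ≋ product (product (h ∘ encode) P) Q R
  product-assoc h P Q R = begin
    product (λ X → product (h ∘ encode) X R) P Q
      ≈⟨ product-cong (λ X → product-encode h X R) P Q ⟩
    product (hR ∘ encode) P Q
      ≈⟨ product-encode hR P Q ⟩
    ∑⧢ (map (padʳ l) u) (map (padˡ k) v)
      (λ t → ∑⧢ (map (padʳ m) t) (map (padˡ (k ℕ.+ l)) w) (λ z → h (k ℕ.+ l ℕ.+ m , z)))
      ≡⟨ ∑⧢-map (padʳ m) (map (padʳ l) u) (map (padˡ k) v) _ ⟨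
    ∑⧢ (map (padʳ m) (map (padʳ l) u)) (map (padʳ m) (map (padˡ k) v))
      (λ t → ∑⧢ t (map (padˡ (k ℕ.+ l)) w) (λ z → h (k ℕ.+ l ℕ.+ m , z)))
      ≈⟨ ∑⧢-assoc (map (padʳ m) (map (padʳ l) u)) _ _ _ ⟩
    ∑⧢ (map (padʳ m) (map (padˡ k) v)) (map (padˡ (k ℕ.+ l)) w)
      (λ t → ∑⧢ (map (padʳ m) (map (padʳ l) u)) t (λ z → h (k ℕ.+ l ℕ.+ m , z)))
      ≡⟨ ≡.cong₂ (λ v w → ∑⧢ v w (λ t → ∑⧢ (map (padʳ m) (map (padʳ l) u)) t
                                            (λ z → h (k ℕ.+ l ℕ.+ m , z)))) v-pad w-pad ⟩
    ∑⧢ (map (padˡ k) (map (padʳ m) v)) (map (padˡ k) (map (padˡ l) w))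
      (λ t → ∑⧢ (map (padʳ m) (map (padʳ l) u)) t (λ z → h (k ℕ.+ l ℕ.+ m , z)))
      ≡⟨ ∑⧢-map (padˡ k) (map (padʳ m) v) (map (padˡ l) w) _ ⟩
    ∑⧢ (map (padʳ m) v) (map (padˡ l) w)
      (λ t → ∑⧢ (map (padʳ m) (map (padʳ l) u)) (map (padˡ k) t) (λ z → h (k ℕ.+ l ℕ.+ m , z)))
      ≡⟨ ≡.cong₂ (λ j u → ∑⧢ (map (padʳ m) v) (map (padˡ l) w)
           (λ t → ∑⧢ u (map (padˡ k) t) (λ z → h (j , z)))) (ℕ.+-assoc k l m) u-pad ⟩
    ∑⧢ (map (padʳ m) v) (map (padˡ l) w)
      (λ t → ∑⧢ (map (padʳ (l ℕ.+ m)) u) (map (padˡ k) t) (λ z → h (k ℕ.+ (l ℕ.+ m) , z)))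
      ≈⟨ product-encode hP Q R ⟨
    product (hP ∘ encode) Q R
      ≈⟨ product-cong (product-encode h P) Q R ⟨
    product (product (h ∘ encode) P) Q R ∎
    where
    k = proj₁ (encode P)
    u = proj₂ (encode P)
    l = proj₁ (encode Q)
    v = proj₂ (encode Q)
    m = proj₁ (encode R)
    w = proj₂ (encode R)
    hR hP : ℕ × Word → Carrier
    hR (j , t) = ∑⧢ (map (padʳ m) t) (map (padˡ j) w) (λ z → h (j ℕ.+ m , z))
    hP (j , t) = ∑⧢ (map (padʳ j) u) (map (padˡ k) t) (λ z → h (k ℕ.+ j , z))
    u-pad : map (padʳ m) (map (padʳ l) u) ≡ map (padʳ (l ℕ.+ m)) u
    u-pad = ≡.trans (≡.sym (List.map-∘ u)) (List.map-cong (λ c → ≡.trans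
      (List.++-assoc c (replicate l outside) _)
      (≡.cong (c ++_) (≡.sym (replicate-+ l m)))) u)
    v-pad : map (padʳ m) (map (padˡ k) v) ≡ map (padˡ k) (map (padʳ m) v)
    v-pad = ≡.trans (≡.sym (List.map-∘ v)) (≡.trans
      (List.map-cong (λ c → List.++-assoc (replicate k outside) c _) v) (List.map-∘ v))
    w-pad : map (padˡ (k ℕ.+ l)) w ≡ map (padˡ k) (map (padˡ l) w)
    w-pad = ≡.trans (List.map-cong (λ c → ≡.trans
      (≡.cong (_++ c) (replicate-+ k l)) (List.++-assoc (replicate k outside) _ c)) w) (List.map-∘ w)

-- The ring structure on formal sums

module _ where

  open Linear ℤ.+-*-ring
  open Shuffle ℤ.+-*-ring

  private
    _≟ᵉ_ : DecidableEquality (ℕ × Word)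
    _≟ᵉ_ = Product.≡-dec ℕ._≟_ (List.≡-dec (List.≡-dec Bool._≟_))

    δ : ℕ × Word → ℕ × Word → ℤ
    δ e e′ = if does (e′ ≟ᵉ e) then 1ℤ else 0ℤ

    δᶜ : AllComp → AllComp → ℤ
    δᶜ P = δ (encode P) ∘ encode

    δ-step : ∀ a Q P → (if does (Q ≟ P) then a else 0ℤ) ≡ a · δᶜ P Q
    δ-step a Q P with Q ≟ P
    ... | yes ≡.refl rewrite dec-true (encode Q ≟ᵉ encode Q) ≡.refl = additive⇒· id (λ _ _ → ≡.refl) a
    ... | no Q≢P rewrite dec-false (encode Q ≟ᵉ encode P) (Q≢P ∘ encode-injective Q P) = ≡.sym (·-zeroʳ a)

  -- Since `encode` is injective, comparing codes selects the same entries as comparing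
  -- compositions. Coefficients are thus functionals of the form `h ∘ encode`, and it suffices to
  -- test ring identities on these.
  coeff≡eval : ∀ x P → coeff x P ≡ eval (δᶜ P) x
  coeff≡eval []            P = ≡.refl
  coeff≡eval ((a , Q) ∷ x) P = ≡.cong₂ ℤ._+_ (δ-step a Q P) (coeff≡eval x P)

  private
    eval-∗̂-assoc : ∀ (h : ℕ × Word → ℤ) x y z →
                   eval (h ∘ encode) ((x ∗̂ y) ∗̂ z) ≡ eval (h ∘ encode) (x ∗̂ (y ∗̂ z))
    eval-∗̂-assoc h x y z = begin
      eval h′ ((x ∗̂ y) ∗̂ z)
        ≡⟨ eval-∗̂ h′ (x ∗̂ y) z ⟩
      eval (λ X → eval (product h′ X) z) (x ∗̂ y)
        ≡⟨ eval-∗̂ _ x y ⟩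
      eval (λ P → eval (λ Q → product (λ X → eval (product h′ X) z) P Q) y) x
        -- The evaluation over `z` is moved outside the finite sum, which leaves a triple product of
        -- basis elements.
        ≡⟨ eval-cong (λ P → eval-cong (λ Q → ≡.sym (eval-∑ (terms (proj₂ P) (proj₂ Q)) _ z)) y) x ⟩
      eval (λ P → eval (λ Q → eval (λ R → product (λ X → product h′ X R) P Q) z) y) x
        ≡⟨ eval-cong (λ P → eval-cong (λ Q → eval-cong (product-assoc h P Q) z) y) x ⟩
      eval (λ P → eval (λ Q → eval (product (product h′ P) Q) z) y) x
        ≡⟨ eval-cong (λ P → eval-∗̂ (product h′ P) y z) x ⟨
      eval (λ P → eval (product h′ P) (y ∗̂ z)) x
        ≡⟨ eval-∗̂ h′ x (y ∗̂ z) ⟨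
      eval h′ (x ∗̂ (y ∗̂ z)) ∎
      where
      open ≡.≡-Reasoning
      h′ = h ∘ encode

    via-eval : ∀ x y → (∀ (h : ℕ × Word → ℤ) → eval (h ∘ encode) x ≡ eval (h ∘ encode) y) → x ≈ y
    via-eval x y eq P =
      ≡.trans (coeff≡eval x P) (≡.trans (eq (δ (encode P))) (≡.sym (coeff≡eval y P)))

  T-isRing : IsRing _≈_ _++_ _∗̂_ -_ [] ⟨ ∅ ⟩
  T-isRing = record
    { +-isAbelianGroup = record
      { isGroup = record
        { isMonoid = record
          { isSemigroup = record
            { isMagma = record
              { isEquivalence = record
                { refl  = λ _ → ≡.refl
                ; sym   = λ x≈y P → ≡.sym (x≈y P)
                ; trans = λ x≈y y≈z P → ≡.trans (x≈y P) (y≈z P)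
                }
              ; ∙-cong = λ {x} {x′} {y} {y′} x≈x′ y≈y′ P → ≡.trans (coeff-++ x y P)
                  (≡.trans (≡.cong₂ ℤ._+_ (x≈x′ P) (y≈y′ P)) (≡.sym (coeff-++ x′ y′ P)))
              }
            ; assoc = λ x y z P → ≡.cong (λ t → coeff t P) (List.++-assoc x y z)
            }
          ; identity = (λ x P → ≡.refl) , (λ x P → ≡.cong (λ t → coeff t P) (List.++-identityʳ x))
          }
        ; inverse = (λ x P → ≡.trans (coeff-++ (- x) x P)
                      (≡.trans (≡.cong (ℤ._+ coeff x P) (coeff-neg x P)) (ℤ.+-inverseˡ (coeff x P))))
                  , (λ x P → ≡.trans (coeff-++ x (- x) P)
                      (≡.trans (≡.cong (ℤ._+_ (coeff x P)) (coeff-neg x P)) (ℤ.+-inverseʳ (coeff x P))))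
        ; ⁻¹-cong = λ {x} {y} x≈y P → ≡.trans (coeff-neg x P)
            (≡.trans (≡.cong ℤ.-_ (x≈y P)) (≡.sym (coeff-neg y P)))
        }
      ; comm = λ x y P → ≡.trans (coeff-++ x y P)
          (≡.trans (ℤ.+-comm (coeff x P) (coeff y P)) (≡.sym (coeff-++ y x P)))
      }
    ; *-cong = λ {x} {x′} {y} {y′} x≈x′ y≈y′ → via-eval (x ∗̂ y) (x′ ∗̂ y′) λ h → begin
        eval (h ∘ encode) (x ∗̂ y)
          ≡⟨ eval-∗̂ _ x y ⟩
        eval (λ P → eval (product (h ∘ encode) P) y) x
          ≡⟨ eval-resp-≈ _ {x} {x′} x≈x′ ⟩
        eval (λ P → eval (product (h ∘ encode) P) y) x′
          ≡⟨ eval-cong (λ P → eval-resp-≈ _ {y} {y′} y≈y′) x′ ⟩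
        eval (λ P → eval (product (h ∘ encode) P) y′) x′
          ≡⟨ eval-∗̂ _ x′ y′ ⟨
        eval (h ∘ encode) (x′ ∗̂ y′) ∎
    ; *-assoc = λ x y z → via-eval ((x ∗̂ y) ∗̂ z) (x ∗̂ (y ∗̂ z)) λ h → eval-∗̂-assoc h x y z
    ; *-identity = (λ x → via-eval (⟨ ∅ ⟩ ∗̂ x) x λ h → begin
        eval (h ∘ encode) (⟨ ∅ ⟩ ∗̂ x)                         ≡⟨ eval-∗̂ _ ⟨ ∅ ⟩ x ⟩
        eval (λ P → eval (product (h ∘ encode) P) x) ⟨ ∅ ⟩     ≡⟨ eval-⟨⟩ (λ P → eval (product (h ∘ encode) P) x) ∅ ⟩
        eval (product (h ∘ encode) ∅) x                       ≡⟨ eval-cong (product-identityˡ h) x ⟩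
        eval (h ∘ encode) x                                   ∎)
      , (λ x → via-eval (x ∗̂ ⟨ ∅ ⟩) x λ h → begin
        eval (h ∘ encode) (x ∗̂ ⟨ ∅ ⟩)                         ≡⟨ eval-∗̂ _ x ⟨ ∅ ⟩ ⟩
        eval (λ P → eval (product (h ∘ encode) P) ⟨ ∅ ⟩) x     ≡⟨ eval-cong (λ P → eval-⟨⟩ (product (h ∘ encode) P) ∅) x ⟩
        eval (λ P → product (h ∘ encode) P ∅) x               ≡⟨ eval-cong (product-identityʳ h) x ⟩
        eval (h ∘ encode) x                                   ∎)
    ; distrib = (λ x y z → via-eval (x ∗̂ (y ++ z)) (x ∗̂ y ++ x ∗̂ z) λ h → begin
        eval (h ∘ encode) (x ∗̂ (y ++ z))
          ≡⟨ eval-∗̂ _ x (y ++ z) ⟩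
        eval (λ P → eval (product (h ∘ encode) P) (y ++ z)) x
          ≡⟨ eval-cong (λ P → eval-++ _ y z) x ⟩
        eval (λ P → eval (product (h ∘ encode) P) y ℤ.+ eval (product (h ∘ encode) P) z) x
          ≡⟨ eval-+ _ _ x ⟩
        eval (λ P → eval (product (h ∘ encode) P) y) x ℤ.+ eval (λ P → eval (product (h ∘ encode) P) z) x
          ≡⟨ ≡.cong₂ ℤ._+_ (eval-∗̂ _ x y) (eval-∗̂ _ x z) ⟨
        eval (h ∘ encode) (x ∗̂ y) ℤ.+ eval (h ∘ encode) (x ∗̂ z)
          ≡⟨ eval-++ _ (x ∗̂ y) (x ∗̂ z) ⟨
        eval (h ∘ encode) (x ∗̂ y ++ x ∗̂ z) ∎)
      , (λ z x y → via-eval ((x ++ y) ∗̂ z) (x ∗̂ z ++ y ∗̂ z) λ h → begin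
        eval (h ∘ encode) ((x ++ y) ∗̂ z)
          ≡⟨ eval-∗̂ _ (x ++ y) z ⟩
        eval (λ P → eval (product (h ∘ encode) P) z) (x ++ y)
          ≡⟨ eval-++ _ x y ⟩
        eval (λ P → eval (product (h ∘ encode) P) z) x ℤ.+ eval (λ P → eval (product (h ∘ encode) P) z) y
          ≡⟨ ≡.cong₂ ℤ._+_ (eval-∗̂ _ x z) (eval-∗̂ _ y z) ⟨
        eval (h ∘ encode) (x ∗̂ z) ℤ.+ eval (h ∘ encode) (y ∗̂ z)
          ≡⟨ eval-++ _ (x ∗̂ z) (y ∗̂ z) ⟨
        eval (h ∘ encode) (x ∗̂ z ++ y ∗̂ z) ∎)
    }
    where open ≡.≡-Reasoning

-- Initial segments and relabelling

module Factorization where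

  open import Data.Nat.Base using (_+_)
  open import Relation.Binary.PropositionalEquality

  -- Empty and full segments are included, whereas `Reduced` asks for `m < n`; for a proper run of
  -- leading blocks the full segment is excluded by `⋃-take-≢⊤`. The constructor `bottom` carries an
  -- equation because the unions to be tested are not literally `⊥`.
  data Initial : Subset n → Set where
    bottom : {X : Subset n} → X ≡ ⊥ → Initial X
    grow   : {X : Subset n} → Initial X → Initial (inside ∷ X)

  initial? : Decidable (Initial {n})
  initial? []            = yes (bottom refl)
  initial? (inside ∷ X)  = map′ grow (λ { (grow i) → i }) (initial? X)
  initial? (outside ∷ X) = map′ (bottom ∘ cong (outside ∷_)) (λ { (bottom e) → Vec.∷-injectiveʳ e })
                                (Vec.≡-dec Bool._≟_ X ⊥)

  initial-zero : ∀ n → initial n 0 ≡ ⊥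
  initial-zero zero    = refl
  initial-zero (suc n) = cong (outside ∷_) (initial-zero n)

  initial⇒Initial : ∀ n m → Initial (initial n m)
  initial⇒Initial n       zero    = bottom (initial-zero n)
  initial⇒Initial zero    (suc m) = bottom refl
  initial⇒Initial (suc n) (suc m) = grow (initial⇒Initial n m)

  Initial⇒initial : {X : Subset n} → Initial X → X ≢ ⊤ → ∃[ m ] m < n × X ≡ initial n m
  Initial⇒initial {zero}  {[]} _ X≢⊤ = contradiction refl X≢⊤
  Initial⇒initial {suc n} (bottom X≡⊥) _ = 0 , s≤s z≤n , trans X≡⊥ (sym (initial-zero (suc n)))
  Initial⇒initial {suc n} (grow i) X≢⊤ with Initial⇒initial i (X≢⊤ ∘ cong (inside ∷_))
  ... | m , m<n , refl = suc m , s≤s m<n , refl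

  relab-⊥ : (A : Subset n) → relab A (⊥ {p}) ≡ ⊥
  relab-⊥ []            = refl
  relab-⊥ (outside ∷ A) = cong (outside ∷_) (relab-⊥ A)
  relab-⊥ {p = zero}  (inside ∷ A) = cong (outside ∷_) (relab-⊥ A)
  relab-⊥ {p = suc p} (inside ∷ A) = cong (outside ∷_) (relab-⊥ A)

  relab-∪ : (A : Subset n) (X Y : Subset p) → relab A (X ∪ Y) ≡ relab A X ∪ relab A Y
  relab-∪ []            X       Y       = refl
  relab-∪ (outside ∷ A) X       Y       = cong (outside ∷_) (relab-∪ A X Y)
  relab-∪ (inside  ∷ A) []      []      = cong (outside ∷_) (relab-∪ A [] [])
  relab-∪ (inside  ∷ A) (x ∷ X) (y ∷ Y) = cong (_ ∷_) (relab-∪ A X Y)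

  relab-⋃ : (A : Subset n) (Ps : List (Subset p)) → ⋃ (map (relab A) Ps) ≡ relab A (⋃ Ps)
  relab-⋃ A []       = sym (relab-⊥ A)
  relab-⋃ A (X ∷ Ps) = trans (cong (relab A X ∪_) (relab-⋃ A Ps)) (sym (relab-∪ A X (⋃ Ps)))

  relab-⊤ : (A : Subset n) → ∣ A ∣ ≡ p → relab A (⊤ {p}) ≡ A
  relab-⊤ A refl = trans (sym (relabel≡relab A ⊤)) (relabel-⊤ A)

  relab-∩ : (A : Subset n) → ∣ A ∣ ≡ p → (X Y : Subset p) → relab A (X ∩ Y) ≡ relab A X ∩ relab A Y
  relab-∩ A refl X Y = trans (sym (relabel≡relab A (X ∩ Y)))
    (trans (relabel-∩ A X Y) (cong₂ _∩_ (relabel≡relab A X) (relabel≡relab A Y)))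

  relab-nonempty⁺ : (A : Subset n) → ∣ A ∣ ≡ p → {X : Subset p} → Nonempty X → Nonempty (relab A X)
  relab-nonempty⁺ A refl {X} = subst Nonempty (relabel≡relab A X) ∘ relabel-nonempty⁺ A

  relab-nonempty⁻ : (A : Subset n) → ∣ A ∣ ≡ p → {X : Subset p} → Nonempty (relab A X) → Nonempty X
  relab-nonempty⁻ A refl {X} = relabel-nonempty⁻ A ∘ subst Nonempty (sym (relabel≡relab A X))

  relab-injective : (A : Subset n) → ∣ A ∣ ≡ p → {X Y : Subset p} → relab A X ≡ relab A Y → X ≡ Y
  relab-injective []            refl {[]}    {[]}    _ = refl
  relab-injective (outside ∷ A) e                    f = relab-injective A e (Vec.∷-injectiveʳ f)
  relab-injective (inside ∷ A)  refl {x ∷ X} {y ∷ Y} f =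
    cong₂ _∷_ (Vec.∷-injectiveˡ f) (relab-injective A refl (Vec.∷-injectiveʳ f))

  relab-surjective : (A : Subset n) → ∣ A ∣ ≡ p → {X : Subset n} → X ⊆ A → Σ[ Z ∈ Subset p ] X ≡ relab A Z
  relab-surjective []            refl {[]} X⊆A = [] , refl
  relab-surjective (outside ∷ A) e {inside ∷ X} X⊆A with () ← X⊆A here
  relab-surjective (outside ∷ A) e {outside ∷ X} X⊆A with relab-surjective A e (drop-∷-⊆ X⊆A)
  ... | Z , refl = Z , refl
  relab-surjective (inside ∷ A) refl {x ∷ X} X⊆A with relab-surjective A refl (drop-∷-⊆ X⊆A)
  ... | Z , refl = x ∷ Z , refl

  -- Relabelling preserves order, so a downward closed image has a downward closed preimage.
  Initial-relab⁻ : (A : Subset n) → ∣ A ∣ ≡ p → {X : Subset p} → Initial (relab A X) → Initial X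
  Initial-relab⁻ []            refl {[]}    _          = bottom refl
  Initial-relab⁻ (outside ∷ A) e            (bottom f) =
    bottom (relab-injective A e (trans (Vec.∷-injectiveʳ f) (sym (relab-⊥ A))))
  Initial-relab⁻ (inside ∷ A)  refl {x ∷ X} (bottom f) =
    bottom (relab-injective (inside ∷ A) refl (trans f (sym (relab-⊥ {p = suc ∣ A ∣} (inside ∷ A)))))
  Initial-relab⁻ (inside ∷ A)  refl {inside ∷ X} (grow i) = grow (Initial-relab⁻ A refl i)

  private
    ∪-relab-⊥ : (A : Subset n) → ∣ ∁ A ∣ ≡ q → {Y : Subset q} → A ∪ relab (∁ A) Y ≡ ⊥ → Y ≡ ⊥
    ∪-relab-⊥ []            refl {[]}    _ = refl
    ∪-relab-⊥ (outside ∷ A) refl {y ∷ Y} f =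
      cong₂ _∷_ (Vec.∷-injectiveˡ f) (∪-relab-⊥ A refl (Vec.∷-injectiveʳ f))

  -- `Y` corresponds to the trace of the union on `∁ A`, and the trace of an initial segment is
  -- initial within `∁ A`.
  Initial-∪-relab⁻ : (A : Subset n) → ∣ ∁ A ∣ ≡ q → {Y : Subset q} →
                     Initial (A ∪ relab (∁ A) Y) → Initial Y
  Initial-∪-relab⁻ []            refl {[]}    _          = bottom refl
  Initial-∪-relab⁻ (inside ∷ A)  e            (grow i)   = Initial-∪-relab⁻ A e i
  Initial-∪-relab⁻ (outside ∷ A) refl {y ∷ Y} (bottom f) = bottom (∪-relab-⊥ (outside ∷ A) refl f)
  Initial-∪-relab⁻ (outside ∷ A) refl {inside ∷ Y} (grow i) = grow (Initial-∪-relab⁻ A refl i)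

  ∪-relab-⊤ : (A : Subset n) → ∣ ∁ A ∣ ≡ q → {Y : Subset q} → A ∪ relab (∁ A) Y ≡ ⊤ → Y ≡ ⊤
  ∪-relab-⊤ []            refl {[]}    _ = refl
  ∪-relab-⊤ (inside ∷ A)  e            f = ∪-relab-⊤ A e (Vec.∷-injectiveʳ f)
  ∪-relab-⊤ (outside ∷ A) refl {y ∷ Y} f =
    cong₂ _∷_ (Vec.∷-injectiveˡ f) (∪-relab-⊤ A refl (Vec.∷-injectiveʳ f))

  -- The subset [p] of [p + q].
  first : ∀ p q → Subset (p + q)
  first zero    q = ⊥
  first (suc p) q = inside ∷ first p q

  ∣first∣ : ∀ p q → ∣ first p q ∣ ≡ p
  ∣first∣ zero    q = ∣⊥∣≡0 q
  ∣first∣ (suc p) q = cong suc (∣first∣ p q)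

  ∣∁first∣ : ∀ p q → ∣ ∁ (first p q) ∣ ≡ q
  ∣∁first∣ p q = ∣∁A∣≡q {p} {q} (first p q) (∣first∣ p q)

  Initial-first : ∀ p q → Initial (first p q)
  Initial-first zero    q = bottom refl
  Initial-first (suc p) q = grow (Initial-first p q)

  Initial⇒≡first : {A : Subset (p + q)} → ∣ A ∣ ≡ p → Initial A → A ≡ first p q
  Initial⇒≡first {zero}  {A = A} e _ = ∣p∣≡0⇒p≡⊥ A e
    where
    ∣p∣≡0⇒p≡⊥ : (A : Subset n) → ∣ A ∣ ≡ 0 → A ≡ ⊥
    ∣p∣≡0⇒p≡⊥ []            _ = refl
    ∣p∣≡0⇒p≡⊥ (outside ∷ A) e = cong (outside ∷_) (∣p∣≡0⇒p≡⊥ A e)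
  Initial⇒≡first {suc p} {q} e (bottom refl) with () ← trans (sym e) (∣⊥∣≡0 (suc p + q))
  Initial⇒≡first {suc p} e (grow i) = cong (inside ∷_) (Initial⇒≡first (ℕ.suc-injective e) i)

  Initial-relab-first : ∀ p q {X : Subset p} → Initial X → Initial (relab (first p q) X)
  Initial-relab-first p       q (bottom refl) = bottom (relab-⊥ (first p q))
  Initial-relab-first (suc p) q (grow i)      = grow (Initial-relab-first p q i)

  Initial-first-∪ : ∀ p q {Y : Subset q} → Initial Y → Initial (first p q ∪ relab (∁ (first p q)) Y)
  Initial-first-∪ zero    q {Y} i = subst Initial (sym (trans (∪-identityˡ _) (relab-∁⊥ Y))) i
    where
    relab-∁⊥ : (Y : Subset n) → relab (∁ ⊥) Y ≡ Y
    relab-∁⊥ []      = refl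
    relab-∁⊥ (y ∷ Y) = cong (y ∷_) (relab-∁⊥ Y)
  Initial-first-∪ (suc p) q i = grow (Initial-first-∪ p q i)

  -- Matching on the view refines the degree itself to `p + q`, so a composition can be cut at the
  -- segment without being transported.
  data InitialView : ∀ n → Subset n → Set where
    view : ∀ p q → InitialView (p + q) (first p q)

  initialView : {X : Subset n} → Initial X → InitialView n X
  initialView (bottom refl) = view 0 _
  initialView (grow i) with view p q ← initialView i = view (suc p) q

  -- Set compositions and their leading blocks

  isSetComposition? : (S : Subset n) (Ps : List (Subset n)) → Dec (IsSetComposition S Ps)
  isSetComposition? S Ps = map′
    (λ (ne , dj , un) → record { nonempty = ne ; disjoint = dj ; union = un })
    (λ ok → let open IsSetComposition ok in nonempty , disjoint , union)
    (All.all? nonempty? Ps ×-dec allPairs? (λ X Y → ¬? (nonempty? (X ∩ Y))) Ps ×-dec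
     Vec.≡-dec Bool._≟_ (⋃ Ps) S)

  -- Validity is stored irrelevantly; as it is decidable, a proof that can be inspected is recovered
  -- by deciding it again.
  isSetComposition : {S : Subset n} (P : SetComposition S) → IsSetComposition S (blocks P)
  isSetComposition {S = S} (setComposition Ps ok) = recompute (isSetComposition? S Ps) ok

  module _ {n} (P : Comp n) where
    open IsSetComposition (isSetComposition P) public
      renaming (nonempty to blocks-nonempty; disjoint to blocks-disjoint; union to ⋃-blocks)

  blocks≡[]⇒∅ : (P : Comp n) → blocks P ≡ [] → _≡_ {A = AllComp} (n , P) ∅
  blocks≡[]⇒∅ {zero}  P e = AllComp-≡ e
  blocks≡[]⇒∅ {suc n} P e with () ← trans (sym (⋃-blocks P)) (cong ⋃ e)

  -- The next block is non-empty and disjoint from the blocks taken, so each of its elements is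
  -- missed.
  ⋃-take-≢⊤ : {Ps : List (Subset n)} → All Nonempty Ps → AllPairs _#_ Ps →
              ∀ a → a < length Ps → ⋃ (take a Ps) ≢ ⊤
  ⋃-take-≢⊤ {Ps = Ps} ne dj a a<l ⋃≡⊤ with missed ne dj a a<l
    where
    missed : {Ps : List (Subset n)} → All Nonempty Ps → AllPairs _#_ Ps →
             ∀ a → a < length Ps → ∃[ Y ] Y ∈ˡ Ps × Nonempty Y × Y # ⋃ (take a Ps)
    missed {Ps = Y ∷ Ps} (y ∷ _)  _        zero    _ = Y , here refl , y , λ (_ , i∈) → ∉⊥ (proj₂ (x∈p∩q⁻ Y ⊥ i∈))
    missed {Ps = X ∷ Ps} (_ ∷ ne) (X# ∷ dj) (suc a) (s≤s a<l) with missed ne dj a a<l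
    ... | Y , Y∈ , y , Y# = Y , there Y∈ , y , λ (i , i∈) → let i∈Y , i∈∪ = x∈p∩q⁻ Y _ i∈ in
          case-∪ i∈Y (x∈p∪q⁻ X _ i∈∪)
      where
      case-∪ : ∀ {i} → i ∈ Y → i ∈ X ⊎ i ∈ ⋃ (take a Ps) → Absurd
      case-∪ i∈Y (inj₁ i∈X) = All.lookup X# Y∈ (_ , x∈p∩q⁺ (i∈X , i∈Y))
      case-∪ i∈Y (inj₂ i∈⋃) = Y# (_ , x∈p∩q⁺ (i∈Y , i∈⋃))
  ... | Y , _ , (i , i∈Y) , Y# = Y# (i , x∈p∩q⁺ (i∈Y , subst (i ∈_) (sym ⋃≡⊤) ∈⊤))

  size : AllComp → ℕ
  size (n , P) = length (blocks P)

  InitialPrefix : ℕ → AllComp → Set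
  InitialPrefix a (n , P) = Initial (⋃ (take a (blocks P)))

  size-generator : (G : Generator) → 1 ≤ size (composition G)
  size-generator (generator (n , P) ne _) with blocks P in eq
  ... | []    = ⊥-elim-irr (ne (blocks≡[]⇒∅ P eq))
  ... | _ ∷ _ = s≤s z≤n

  ¬InitialPrefix : (G : Generator) → ∀ a → 1 ≤ a → a < size (composition G) →
                   ¬ InitialPrefix a (composition G)
  ¬InitialPrefix (generator (n , P) _ red) a 1≤a a<l i
    with Initial⇒initial i (⋃-take-≢⊤ (blocks-nonempty P) (blocks-disjoint P) a a<l)
  ... | m , m<n , e = ⊥-elim-irr (red (a , m , 1≤a , a<l , m<n , e))

  take-++-≤ : ∀ {x} {X : Set x} a (xs ys : List X) → a ≤ length xs → take a (xs ++ ys) ≡ take a xs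
  take-++-≤ zero    xs       ys _         = refl
  take-++-≤ (suc a) (x ∷ xs) ys (s≤s a≤l) = cong (x ∷_) (take-++-≤ a xs ys a≤l)

  drop-length-++ : ∀ {x} {X : Set x} (xs ys : List X) → drop (length xs) (xs ++ ys) ≡ ys
  drop-length-++ []       ys = refl
  drop-length-++ (x ∷ xs) ys = drop-length-++ xs ys

  take-length : ∀ {x} {X : Set x} (xs : List X) → take (length xs) xs ≡ xs
  take-length []       = refl
  take-length (x ∷ xs) = cong (x ∷_) (take-length xs)

  module _ (P : Comp p) (Q : Comp q) (A : Subset (p + q)) (e : ∣ A ∣ ≡ p) where

    take-term : ∀ a → a ≤ length (blocks P) →
                take a (blocks (term P Q A e)) ≡ map (relab A) (take a (blocks P))
    take-term a a≤l = begin
      take a (blocks (term P Q A e))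
        ≡⟨ cong (take a) (blocks-term P Q A e) ⟩
      take a (map (relab A) (blocks P) ++ _)
        ≡⟨ take-++-≤ a (map (relab A) (blocks P)) _ (subst (a ≤_) (sym (List.length-map _ (blocks P))) a≤l) ⟩
      take a (map (relab A) (blocks P))
        ≡⟨ List.take-map a (blocks P) ⟩
      map (relab A) (take a (blocks P)) ∎
      where open ≡-Reasoning

    take-size-term : take (length (blocks P)) (blocks (term P Q A e)) ≡ map (relab A) (blocks P)
    take-size-term = trans (take-term _ ℕ.≤-refl) (cong (map (relab A)) (take-length (blocks P)))

    drop-size-term : drop (length (blocks P)) (blocks (term P Q A e)) ≡ map (relab (∁ A)) (blocks Q)
    drop-size-term = begin
      drop (length (blocks P)) (blocks (term P Q A e))
        ≡⟨ cong₂ drop (sym (List.length-map (relab A) (blocks P))) (blocks-term P Q A e) ⟩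
      drop (length (map (relab A) (blocks P))) (map (relab A) (blocks P) ++ map (relab (∁ A)) (blocks Q))
        ≡⟨ drop-length-++ (map (relab A) (blocks P)) _ ⟩
      map (relab (∁ A)) (blocks Q) ∎
      where open ≡-Reasoning

    ⋃-take-term : ∀ a → a ≤ length (blocks P) →
                  ⋃ (take a (blocks (term P Q A e))) ≡ relab A (⋃ (take a (blocks P)))
    ⋃-take-term a a≤l = trans (cong ⋃ (take-term a a≤l)) (relab-⋃ A (take a (blocks P)))

    ⋃-take-size-term : ⋃ (take (length (blocks P)) (blocks (term P Q A e))) ≡ A
    ⋃-take-size-term = begin
      ⋃ (take (length (blocks P)) (blocks (term P Q A e))) ≡⟨ cong ⋃ take-size-term ⟩
      ⋃ (map (relab A) (blocks P))                         ≡⟨ relab-⋃ A (blocks P) ⟩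
      relab A (⋃ (blocks P))                               ≡⟨ cong (relab A) (⋃-blocks P) ⟩
      relab A ⊤                                            ≡⟨ relab-⊤ A e ⟩
      A                                                    ∎
      where open ≡-Reasoning

  -- Shifted concatenation and unique factorization

  infixr 7 _▷_

  _▷_ : AllComp → AllComp → AllComp
  (p , P) ▷ (q , Q) = p + q , term P Q (first p q) (∣first∣ p q)

  module _ (G : Generator) (Q : AllComp) where

    -- Together with `¬InitialPrefix-<` this locates the end of `G` as the first break of `G ▷ Q`,
    -- so the product alone determines where to cut.
    InitialPrefix-size : InitialPrefix (size (composition G)) (composition G ▷ Q)
    InitialPrefix-size = subst Initial
      (sym (⋃-take-size-term (proj₂ (composition G)) (proj₂ Q) _ (∣first∣ _ (proj₁ Q))))
      (Initial-first _ (proj₁ Q))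

    ¬InitialPrefix-< : ∀ a → 1 ≤ a → a < size (composition G) → ¬ InitialPrefix a (composition G ▷ Q)
    ¬InitialPrefix-< a 1≤a a<l i = ¬InitialPrefix G a 1≤a a<l
      (Initial-relab⁻ (first _ (proj₁ Q)) (∣first∣ _ (proj₁ Q)) (subst Initial
        (⋃-take-term (proj₂ (composition G)) (proj₂ Q) _ (∣first∣ _ (proj₁ Q)) a (ℕ.<⇒≤ a<l)) i))

  private
    blocks-cong : {P Q : Comp n} → _≡_ {A = AllComp} (n , P) (n , Q) → blocks P ≡ blocks Q
    blocks-cong refl = refl

    term-injective : (P P′ : Comp p) (Q Q′ : Comp q) → length (blocks P) ≡ length (blocks P′) →
                     (p , P) ▷ (q , Q) ≡ (p , P′) ▷ (q , Q′) →
                     _≡_ {A = AllComp} (p , P) (p , P′) × _≡_ {A = AllComp} (q , Q) (q , Q′)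
    term-injective {p} {q} P P′ Q Q′ l e =
        AllComp-≡ (List.map-injective (relab-injective A (∣first∣ p q)) (begin
          map (relab A) (blocks P)                                     ≡⟨ take-size-term P Q A (∣first∣ p q) ⟨
          take (length (blocks P)) (blocks (proj₂ ((p , P) ▷ (q , Q))))     ≡⟨ cong₂ take l (blocks-cong e) ⟩
          take (length (blocks P′)) (blocks (proj₂ ((p , P′) ▷ (q , Q′))))  ≡⟨ take-size-term P′ Q′ A (∣first∣ p q) ⟩
          map (relab A) (blocks P′)                                    ∎))
      , AllComp-≡ (List.map-injective (relab-injective (∁ A) (∣∁first∣ p q)) (begin
          map (relab (∁ A)) (blocks Q)                                 ≡⟨ drop-size-term P Q A (∣first∣ p q) ⟨
          drop (length (blocks P)) (blocks (proj₂ ((p , P) ▷ (q , Q))))     ≡⟨ cong₂ drop l (blocks-cong e) ⟩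
          drop (length (blocks P′)) (blocks (proj₂ ((p , P′) ▷ (q , Q′))))  ≡⟨ drop-size-term P′ Q′ A (∣first∣ p q) ⟩
          map (relab (∁ A)) (blocks Q′)                                ∎))
      where
      A = first p q
      open ≡-Reasoning

    generator-≡ : {G G′ : Generator} → composition G ≡ composition G′ → G ≡ G′
    generator-≡ {generator _ _ _} {generator _ _ _} refl = refl

  -- If one generator had fewer blocks, its end would be a break inside the other. Once the numbers
  -- of blocks agree, the degrees agree as well, and relabelling is injective on each factor.
  ▷-injective : ∀ G Q G′ Q′ → composition G ▷ Q ≡ composition G′ ▷ Q′ → G ≡ G′ × Q ≡ Q′
  ▷-injective G Q G′ Q′ e = go sizes
    where
    sizes : size (composition G) ≡ size (composition G′)
    sizes with ℕ.<-cmp (size (composition G)) (size (composition G′))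
    ... | tri< l< _ _ = contradiction (subst (InitialPrefix (size (composition G))) e (InitialPrefix-size G Q))
                          (¬InitialPrefix-< G′ Q′ (size (composition G)) (size-generator G) l<)
    ... | tri≈ _ l≡ _ = l≡
    ... | tri> _ _ l> = contradiction (subst (InitialPrefix (size (composition G′))) (sym e) (InitialPrefix-size G′ Q′))
                          (¬InitialPrefix-< G Q (size (composition G′)) (size-generator G′) l>)
    -- The degree of the left factor is the number of elements in its blocks, hence readable from
    -- the concatenation.
    card : AllComp → ℕ
    card (n , P) = ∣ ⋃ (take (size (composition G)) (blocks P)) ∣
    card-▷ : ∀ (F R : AllComp) → size F ≡ size (composition G) → card (F ▷ R) ≡ proj₁ F
    card-▷ (p , P) (q , R) l rewrite sym l =
      trans (cong ∣_∣ (⋃-take-size-term P R (first p q) (∣first∣ p q))) (∣first∣ p q)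
    degree≡ : proj₁ (composition G) ≡ proj₁ (composition G′)
    degree≡ = trans (sym (card-▷ (composition G) Q refl))
                    (trans (cong card e) (card-▷ (composition G′) Q′ (sym sizes)))
    -- Stated for general compositions so that the equations between degrees can be matched with
    -- `refl`.
    split : ∀ P Q P′ Q′ → size P ≡ size P′ → proj₁ P ≡ proj₁ P′ → proj₁ Q ≡ proj₁ Q′ →
            P ▷ Q ≡ P′ ▷ Q′ → P ≡ P′ × Q ≡ Q′
    split (p , P) (q , Q) (_ , P′) (_ , Q′) l refl refl e = term-injective P P′ Q Q′ l e
    go : size (composition G) ≡ size (composition G′) → G ≡ G′ × Q ≡ Q′
    go l with split (composition G) Q (composition G′) Q′ l degree≡
                (ℕ.+-cancelˡ-≡ (proj₁ (composition G)) _ _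
                  (trans (cong proj₁ e) (cong (_+ proj₁ Q′) (sym degree≡)))) e
    ... | G≡ , Q≡ = generator-≡ G≡ , Q≡

  size-▷ : ∀ P Q → size (P ▷ Q) ≡ size P + size Q
  size-▷ (p , P) (q , Q) = trans (cong length (blocks-term P Q A (∣first∣ p q)))
    (trans (List.length-++ (map (relab A) (blocks P)))
           (cong₂ _+_ (List.length-map _ (blocks P)) (List.length-map _ (blocks Q))))
    where A = first p q

  ▷-≢∅ : ∀ G Q → composition G ▷ Q ≢ ∅
  ▷-≢∅ G Q e with () ← ℕ.≤-trans (ℕ.≤-trans (size-generator G) (ℕ.m≤m+n _ (size Q)))
                         (ℕ.≤-reflexive (trans (sym (size-▷ (composition G) Q)) (cong size e)))

  least : ∀ {ℓ} {D : Pred ℕ ℓ} → Decidable D → ∀ k → D k → ∃[ a ] D a × (∀ b → b < a → ¬ D b)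
  least D? zero    d = 0 , d , λ _ ()
  least D? (suc k) d with D? 0
  ... | yes d₀ = 0 , d₀ , λ _ ()
  ... | no ¬d₀ with least (D? ∘ suc) k d
  ...   | a , dₐ , min = suc a , dₐ , λ { zero _ → ¬d₀ ; (suc b) (s≤s b<a) → min b b<a }

  ⊆∁ : (X A : Subset n) → X # A → X ⊆ ∁ A
  ⊆∁ X A X#A {i} i∈X with i ∈? ∁ A
  ... | yes i∈∁ = i∈∁
  ... | no i∉∁ = contradiction (i , x∈p∩q⁺ (i∈X , x∉∁p⇒x∈p i∉∁)) X#A

  All-∃⇒map : ∀ {x y} {X : Set x} {Y : Set y} {f : X → Y} {ys} →
              All (λ y → Σ[ x ∈ X ] y ≡ f x) ys → Σ[ xs ∈ List X ] ys ≡ map f xs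
  All-∃⇒map []                = [] , refl
  All-∃⇒map ((x , refl) ∷ ps) with All-∃⇒map ps
  ... | xs , refl = x ∷ xs , refl

  #-⋃ : {Y : Subset n} (Xs : List (Subset n)) → All (_# Y) Xs → Y # ⋃ Xs
  #-⋃ {Y = Y} []       []        (_ , i∈) = ∉⊥ (proj₂ (x∈p∩q⁻ Y ⊥ i∈))
  #-⋃ {Y = Y} (X ∷ Xs) (X# ∷ Xs#) (i , i∈) with x∈p∩q⁻ Y _ i∈
  ... | i∈Y , i∈∪ with x∈p∪q⁻ X _ i∈∪
  ...   | inj₁ i∈X = X# (i , x∈p∩q⁺ (i∈X , i∈Y))
  ...   | inj₂ i∈⋃ = #-⋃ Xs Xs# (i , x∈p∩q⁺ (i∈Y , i∈⋃))

  AllPairs-++⁻ : ∀ {x r} {X : Set x} {R : X → X → Set r} xs {ys} → AllPairs R (xs ++ ys) →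
                 AllPairs R xs × AllPairs R ys × All (λ y → All (λ x → R x y) xs) ys
  AllPairs-++⁻ []       Rys = [] , Rys , All.universal (λ _ → []) _
  AllPairs-++⁻ (x ∷ xs) (Rx ∷ R) with AllPairs-++⁻ xs R
  ... | Rxs , Rys , Rxsys = All.++⁻ˡ xs Rx ∷ Rxs , Rys , All.zipWith (λ (r , rs) → r ∷ rs) (All.++⁻ʳ xs Rx , Rxsys)

  relab-#⁻ : (A : Subset n) → ∣ A ∣ ≡ p → {X Y : Subset p} → relab A X # relab A Y → X # Y
  relab-#⁻ A e {X} {Y} X#Y = X#Y ∘ subst Nonempty (relab-∩ A e X Y) ∘ relab-nonempty⁺ A e

  private
    module _ (A : Subset n) (∣A∣≡p : ∣ A ∣ ≡ p) (∣∁A∣≡q : ∣ ∁ A ∣ ≡ q) where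

      split-valid : (Gs : List (Subset p)) (Qs : List (Subset q)) →
                    IsSetComposition ⊤ (map (relab A) Gs ++ map (relab (∁ A)) Qs) →
                    ⋃ (map (relab A) Gs) ≡ A → IsSetComposition ⊤ Gs × IsSetComposition ⊤ Qs
      split-valid Gs Qs ok ⋃≡A = record
        { nonempty = All.map (relab-nonempty⁻ A ∣A∣≡p) (All.map⁻ (All.++⁻ˡ (map (relab A) Gs) nonempty))
        ; disjoint = AllPairs.map (λ {X} {Y} → relab-#⁻ A ∣A∣≡p {X} {Y}) (AllPairs.map⁻ (proj₁ disjoints))
        ; union    = relab-injective A ∣A∣≡p (trans (sym (relab-⋃ A Gs)) (trans ⋃≡A (sym (relab-⊤ A ∣A∣≡p))))
        } , record
        { nonempty = All.map (relab-nonempty⁻ (∁ A) ∣∁A∣≡q) (All.map⁻ (All.++⁻ʳ (map (relab A) Gs) nonempty))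
        ; disjoint = AllPairs.map (λ {X} {Y} → relab-#⁻ (∁ A) ∣∁A∣≡q {X} {Y}) (AllPairs.map⁻ (proj₁ (proj₂ disjoints)))
        ; union    = ∪-relab-⊤ A ∣∁A∣≡q (begin
            A ∪ relab (∁ A) (⋃ Qs)                              ≡⟨ cong₂ _∪_ ⋃≡A (relab-⋃ (∁ A) Qs) ⟨
            ⋃ (map (relab A) Gs) ∪ ⋃ (map (relab (∁ A)) Qs)     ≡⟨ ⋃-++ (map (relab A) Gs) _ ⟨
            ⋃ (map (relab A) Gs ++ map (relab (∁ A)) Qs)        ≡⟨ union ⟩
            ⊤                                                   ∎)
        }
        where
        open IsSetComposition ok
        open ≡-Reasoning
        disjoints = AllPairs-++⁻ (map (relab A) Gs) disjoint

      -- The blocks of `Xs` lie in their union `A`, those of `Ys` are disjoint from it and lie in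
      -- `∁ A`; each is therefore the relabelling of a subset of the smaller ground set.
      blocks-split : (Xs Ys : List (Subset n)) → IsSetComposition ⊤ (Xs ++ Ys) → ⋃ Xs ≡ A →
        Σ[ Gs ∈ List (Subset p) ] Σ[ Qs ∈ List (Subset q) ]
          Xs ≡ map (relab A) Gs × Ys ≡ map (relab (∁ A)) Qs ×
          IsSetComposition ⊤ Gs × IsSetComposition ⊤ Qs
      blocks-split Xs Ys ok refl with AllPairs-++⁻ Xs (IsSetComposition.disjoint ok)
      ... | _ , _ , Xs#Ys
        with All-∃⇒map (All.map {P = _⊆ A} (λ X⊆A → relab-surjective A ∣A∣≡p X⊆A) (⋃-upper Xs))
           | All-∃⇒map (All.map (λ {Y} Xs#Y → relab-surjective (∁ A) ∣∁A∣≡q (⊆∁ Y A (#-⋃ Xs Xs#Y))) Xs#Ys)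
      ... | Gs , eqG | Qs , eqQ = Gs , Qs , eqG , eqQ , split-valid Gs Qs
        (subst₂ (λ Xs Ys → IsSetComposition ⊤ (Xs ++ Ys)) eqG eqQ ok) (cong ⋃ (sym eqG))

    factorize-first : (P : Comp (p + q)) (a : ℕ) → 1 ≤ length (take a (blocks P)) →
      ⋃ (take a (blocks P)) ≡ first p q →
      (∀ b → 1 ≤ b → b < a → ¬ Initial (⋃ (take b (blocks P)))) →
      Σ[ G ∈ Generator ] Σ[ Q ∈ AllComp ] (p + q , P) ≡ composition G ▷ Q
    factorize-first {p} {q} P a 1≤l ⋃≡ minimal
      with blocks-split (first p q) (∣first∣ p q) (∣∁first∣ p q) (take a (blocks P)) (drop a (blocks P))
             (subst (IsSetComposition ⊤) (sym (List.take++drop≡id a (blocks P))) (isSetComposition P)) ⋃≡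
    ... | Gs , Qs , eqG , eqQ , okG , okQ =
      generator (p , G) (λ { refl → 1≰0 (subst (λ Xs → 1 ≤ length Xs) eqG 1≤l) }) reducedG , (q , Q) ,
      AllComp-≡ (begin
        blocks P                                    ≡⟨ List.take++drop≡id a (blocks P) ⟨
        take a (blocks P) ++ drop a (blocks P)      ≡⟨ cong₂ _++_ eqG eqQ ⟩
        map (relab A) Gs ++ map (relab (∁ A)) Qs    ≡⟨ blocks-term G Q A (∣first∣ p q) ⟨
        blocks (term G Q A (∣first∣ p q))           ∎)
      where
      open ≡-Reasoning
      A = first p q
      G : Comp p
      G = setComposition Gs okG
      Q : Comp q
      Q = setComposition Qs okQ
      1≰0 : ¬ (1 ≤ 0)
      1≰0 ()
      length-Gs : length Gs ≤ a
      length-Gs = ℕ.≤-trans (ℕ.≤-reflexive (trans (sym (List.length-map (relab A) Gs)) (cong length (sym eqG))))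
        (ℕ.≤-trans (ℕ.≤-reflexive (List.length-take a (blocks P))) (ℕ.m⊓n≤m a _))
      take-take : ∀ {x} {X : Set x} b a (xs : List X) → b ≤ a → take b (take a xs) ≡ take b xs
      take-take zero    a       xs       _         = refl
      take-take (suc b) (suc a) []       _         = refl
      take-take (suc b) (suc a) (x ∷ xs) (s≤s b≤a) = cong (x ∷_) (take-take b a xs b≤a)
      -- A violation inside `G` would be, after relabelling along an initial segment, a break of `P`
      -- before `a`.
      reducedG : Reduced (p , G)
      reducedG (b , m , 1≤b , b<l , m<p , e) = minimal b 1≤b b<a
        (subst Initial (begin
          relab A (⋃ (take b Gs))             ≡⟨ relab-⋃ A (take b Gs) ⟨
          ⋃ (map (relab A) (take b Gs))       ≡⟨ cong ⋃ (List.take-map b Gs) ⟨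
          ⋃ (take b (map (relab A) Gs))       ≡⟨ cong (⋃ ∘ take b) eqG ⟨
          ⋃ (take b (take a (blocks P)))      ≡⟨ cong ⋃ (take-take b a (blocks P) (ℕ.<⇒≤ b<a)) ⟩
          ⋃ (take b (blocks P))               ∎)
          (Initial-relab-first p q (subst Initial (sym e) (initial⇒Initial p m))))
        where
        b<a : b < a
        b<a = ℕ.<-≤-trans b<l length-Gs

    Initial-⊤ : ∀ n → Initial (⊤ {n})
    Initial-⊤ zero    = bottom refl
    Initial-⊤ (suc n) = grow (Initial-⊤ n)

  factorize : (P : AllComp) → P ≡ ∅ ⊎ Σ[ G ∈ Generator ] Σ[ Q ∈ AllComp ] P ≡ composition G ▷ Q
  factorize (n , P) with blocks P in eq
  ... | [] = inj₁ (blocks≡[]⇒∅ P eq)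
  -- The shift by `suc` rules out the empty run of blocks. The search succeeds because all blocks
  -- together give the full segment.
  ... | X ∷ Xs with least {D = λ a → Initial (⋃ (take (suc a) (blocks P)))} (λ a → initial? _) (length Xs)
                     (subst Initial (trans (sym (⋃-blocks P)) (cong ⋃ (take-all eq))) (Initial-⊤ n))
    where
    take-all : ∀ {Ps} → Ps ≡ X ∷ Xs → Ps ≡ take (suc (length Xs)) Ps
    take-all refl = sym (take-length (X ∷ Xs))
  ...   | a , i , minimal = inj₂ (go P (⋃ (take (suc a) (blocks P))) refl (initialView i)
            (subst (λ Ps → 1 ≤ length (take (suc a) Ps)) (sym eq) (s≤s z≤n))
            (λ { (suc b) _ (s≤s b<a) → minimal b b<a }))
    where
    -- Degree and union are generalized so that matching on the view can specialize them.
    go : ∀ {n} (P : Comp n) X → ⋃ (take (suc a) (blocks P)) ≡ X → InitialView n X →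
         1 ≤ length (take (suc a) (blocks P)) →
         (∀ b → 1 ≤ b → b < suc a → ¬ Initial (⋃ (take b (blocks P)))) →
         Σ[ G ∈ Generator ] Σ[ Q ∈ AllComp ] (n , P) ≡ composition G ▷ Q
    go P _ e (view p q) 1≤l minimal = factorize-first {p} {q} P (suc a) 1≤l e minimal

  -- Counting breaks

  prefixes : Subset n → List (Subset n) → List (Subset n)
  prefixes U []       = []
  prefixes U (X ∷ Ps) = U ∪ X ∷ prefixes (U ∪ X) Ps

  prefixes-++ : ∀ (U : Subset n) Ps Qs → prefixes U (Ps ++ Qs) ≡ prefixes U Ps ++ prefixes (U ∪ ⋃ Ps) Qs
  prefixes-++ U []       Qs = cong (λ V → prefixes V Qs) (sym (∪-identityʳ U))
  prefixes-++ U (X ∷ Ps) Qs = cong (U ∪ X ∷_) (trans (prefixes-++ (U ∪ X) Ps Qs)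
    (cong (λ V → prefixes (U ∪ X) Ps ++ prefixes V Qs) (∪-assoc U X (⋃ Ps))))

  -- Two maps are needed for the right factor of a term: its blocks are relabelled by `relab (∁ A)`,
  -- while its running unions also contain `A`.
  prefixes-map : (f g : Subset p → Subset n) → (∀ U X → f (U ∪ X) ≡ f U ∪ g X) →
                 ∀ U Ps → prefixes (f U) (map g Ps) ≡ map f (prefixes U Ps)
  prefixes-map f g f-∪ U []       = refl
  prefixes-map f g f-∪ U (X ∷ Ps) = cong₂ _∷_ (sym (f-∪ U X))
    (trans (cong (λ V → prefixes V (map g Ps)) (sym (f-∪ U X))) (prefixes-map f g f-∪ (U ∪ X) Ps))

  prefixes-All : ∀ {ℓ} {B : Pred (Subset n) ℓ} U Ps →
    (∀ a → 1 ≤ a → a ≤ length Ps → B (U ∪ ⋃ (take a Ps))) → All B (prefixes U Ps)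
  prefixes-All         U []       b = []
  prefixes-All {B = B} U (X ∷ Ps) b =
    subst (λ V → B (U ∪ V)) (∪-identityʳ X) (b 1 (s≤s z≤n) (s≤s z≤n)) ∷
    prefixes-All (U ∪ X) Ps (λ a 1≤a a≤l →
      subst B (sym (∪-assoc U X (⋃ (take a Ps)))) (b (suc a) (s≤s z≤n) (s≤s a≤l)))

  prefixes-last : (U : Subset n) (Ps : List (Subset n)) → 1 ≤ length Ps → U ∪ ⋃ Ps ∈ˡ prefixes U Ps
  prefixes-last U (X ∷ [])     _ = here (cong (U ∪_) (∪-identityʳ X))
  prefixes-last U (X ∷ Y ∷ Ps) _ = there (subst (_∈ˡ prefixes (U ∪ X) (Y ∷ Ps)) (∪-assoc U X _) (prefixes-last (U ∪ X) (Y ∷ Ps) (s≤s z≤n)))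

  countInitial : List (Subset n) → ℕ
  countInitial = length ∘ filter initial?

  -- The number of factors of P in its decomposition into generators.
  rank : AllComp → ℕ
  rank (n , P) = countInitial (prefixes ⊥ (blocks P))

  countInitial-map-≤ : (f : Subset p → Subset n) → (∀ {X} → Initial (f X) → Initial X) →
                       ∀ Xs → countInitial (map f Xs) ≤ countInitial Xs
  countInitial-map-≤ f f⁻ []       = z≤n
  countInitial-map-≤ f f⁻ (X ∷ Xs) with initial? (f X) | initial? X
  ... | yes _ | yes _ = s≤s (countInitial-map-≤ f f⁻ Xs)
  ... | yes i | no ¬i = contradiction (f⁻ i) ¬i
  ... | no _  | yes _ = ℕ.m≤n⇒m≤1+n (countInitial-map-≤ f f⁻ Xs)
  ... | no _  | no _  = countInitial-map-≤ f f⁻ Xs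

  countInitial-map-≥ : (f : Subset p → Subset n) → (∀ {X} → Initial X → Initial (f X)) →
                       ∀ Xs → countInitial Xs ≤ countInitial (map f Xs)
  countInitial-map-≥ f f⁺ []       = z≤n
  countInitial-map-≥ f f⁺ (X ∷ Xs) with initial? (f X) | initial? X
  ... | yes _ | yes _ = s≤s (countInitial-map-≥ f f⁺ Xs)
  ... | no ¬i | yes i = contradiction (f⁺ i) ¬i
  ... | yes _ | no _  = ℕ.m≤n⇒m≤1+n (countInitial-map-≥ f f⁺ Xs)
  ... | no _  | no _  = countInitial-map-≥ f f⁺ Xs

  -- The blocks of `P` come first and exhaust `A`, so the running unions within `Q` start from `A`
  -- in place of `⊥`.
  rank-term : (P : Comp p) (Q : Comp q) (A : Subset (p + q)) (e : ∣ A ∣ ≡ p) →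
    rank (p + q , term P Q A e) ≡
    countInitial (map (relab A) (prefixes ⊥ (blocks P))) +
    countInitial (map (λ Y → A ∪ relab (∁ A) Y) (prefixes ⊥ (blocks Q)))
  rank-term {p} {q} P Q A e = begin
    countInitial (prefixes ⊥ (blocks (term P Q A e)))
      ≡⟨ cong (countInitial ∘ prefixes ⊥) (blocks-term P Q A e) ⟩
    countInitial (prefixes ⊥ (Ps ++ Qs))
      ≡⟨ cong countInitial (prefixes-++ ⊥ Ps Qs) ⟩
    countInitial (prefixes ⊥ Ps ++ prefixes (⊥ ∪ ⋃ Ps) Qs)
      ≡⟨ cong length (List.filter-++ initial? (prefixes ⊥ Ps) _) ⟩
    length (filter initial? (prefixes ⊥ Ps) ++ filter initial? (prefixes (⊥ ∪ ⋃ Ps) Qs))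
      ≡⟨ List.length-++ (filter initial? (prefixes ⊥ Ps)) ⟩
    countInitial (prefixes ⊥ Ps) + countInitial (prefixes (⊥ ∪ ⋃ Ps) Qs)
      ≡⟨ cong₂ (λ U V → countInitial (prefixes U Ps) + countInitial (prefixes V Qs))
           (sym (relab-⊥ A)) ⊥∪⋃Ps ⟩
    countInitial (prefixes (relab A ⊥) Ps) + countInitial (prefixes (A ∪ relab (∁ A) ⊥) Qs)
      ≡⟨ cong₂ (λ Us Vs → countInitial Us + countInitial Vs)
           (prefixes-map (relab A) (relab A) (relab-∪ A) ⊥ (blocks P))
           (prefixes-map (λ Y → A ∪ relab (∁ A) Y) (relab (∁ A))
             (λ U X → trans (cong (A ∪_) (relab-∪ (∁ A) U X)) (sym (∪-assoc A _ _))) ⊥ (blocks Q)) ⟩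
    countInitial (map (relab A) (prefixes ⊥ (blocks P))) +
    countInitial (map (λ Y → A ∪ relab (∁ A) Y) (prefixes ⊥ (blocks Q))) ∎
    where
    open ≡-Reasoning
    Ps = map (relab A) (blocks P)
    Qs = map (relab (∁ A)) (blocks Q)
    ⊥∪⋃Ps : ⊥ ∪ ⋃ Ps ≡ A ∪ relab (∁ A) (⊥ {q})
    ⊥∪⋃Ps = begin
      ⊥ ∪ ⋃ Ps                     ≡⟨ ∪-identityˡ _ ⟩
      ⋃ Ps                         ≡⟨ relab-⋃ A (blocks P) ⟩
      relab A (⋃ (blocks P))       ≡⟨ cong (relab A) (⋃-blocks P) ⟩
      relab A ⊤                    ≡⟨ relab-⊤ A e ⟩
      A                            ≡⟨ ∪-identityʳ A ⟨
      A ∪ ⊥                        ≡⟨ cong (A ∪_) (relab-⊥ (∁ A)) ⟨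
      A ∪ relab (∁ A) (⊥ {q})      ∎

  -- The end of `G` is a break, and shifting past an initial segment preserves every break of `Q`.
  rank-▷ : ∀ G Q → rank Q < rank (composition G ▷ Q)
  rank-▷ G (q , Q) = ℕ.≤-trans (ℕ.+-mono-≤ breaks (countInitial-map-≥ _ (Initial-first-∪ d q) (prefixes ⊥ (blocks Q))))
                               (ℕ.≤-reflexive (sym (rank-term P Q A (∣first∣ d q))))
    where
    d = proj₁ (composition G)
    P = proj₂ (composition G)
    A = first d q
    break : Initial (relab A (⊥ ∪ ⋃ (blocks P)))
    break = subst Initial
      (sym (trans (cong (relab A) (trans (∪-identityˡ _) (⋃-blocks P))) (relab-⊤ A (∣first∣ d q))))
      (Initial-first d q)
    breaks : 1 ≤ countInitial (map (relab A) (prefixes ⊥ (blocks P)))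
    breaks = List.filter-some initial? (Any.map⁺ (Any.map (λ { refl → break })
               (prefixes-last ⊥ (blocks P) (size-generator G))))

  rank-other : ∀ G Q A e → A ≢ first (proj₁ (composition G)) (proj₁ Q) →
               rank (_ , term (proj₂ (composition G)) (proj₂ Q) A e) ≤ rank Q
  rank-other G (q , Q) A e A≢ = begin
    rank (d + q , term P Q A e)
      ≡⟨ rank-term P Q A e ⟩
    countInitial (map (relab A) (prefixes ⊥ (blocks P))) + countInitial (map _ (prefixes ⊥ (blocks Q)))
      ≡⟨ cong (λ k → k + countInitial (map (λ Y → A ∪ relab (∁ A) Y) (prefixes ⊥ (blocks Q))))
           (cong length (List.filter-none initial? (All.map⁺ (prefixes-All ⊥ (blocks P) no-break)))) ⟩
    countInitial (map _ (prefixes ⊥ (blocks Q)))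
      ≤⟨ countInitial-map-≤ _ (Initial-∪-relab⁻ A (∣∁A∣≡q {d} {q} A e)) (prefixes ⊥ (blocks Q)) ⟩
    rank (q , Q) ∎
    where
    open ℕ.≤-Reasoning
    d = proj₁ (composition G)
    P = proj₂ (composition G)
    no-break : ∀ a → 1 ≤ a → a ≤ length (blocks P) → ¬ Initial (relab A (⊥ ∪ ⋃ (take a (blocks P))))
    no-break a 1≤a a≤l i with ℕ.m≤n⇒m<n∨m≡n a≤l
    ... | inj₁ a<l  = ¬InitialPrefix G a 1≤a a<l
      (Initial-relab⁻ A e (subst (Initial ∘ relab A) (∪-identityˡ _) i))
    -- At the end of `G` the union is `A`, and an initial segment with `d` elements can only be
    -- `first d q`.
    ... | inj₂ refl = A≢ (Initial⇒≡first e (subst Initial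
      (trans (cong (relab A) (trans (∪-identityˡ _) (trans (cong ⋃ (take-length (blocks P))) (⋃-blocks P))))
             (relab-⊤ A e)) i))

  -- Splitting the shifted concatenation off a product

  before after : Subset n → List (Subset n)
  before []                      = []
  before (inside ∷ A)            = map (inside ∷_) (before A)
  before {suc n} (outside ∷ A)   = map (inside ∷_) (subsets n) ++ map (outside ∷_) (before A)
  after []                       = []
  after {suc n} (inside ∷ A)     = map (inside ∷_) (after A) ++ map (outside ∷_) (subsets n)
  after (outside ∷ A)            = map (outside ∷_) (after A)

  -- `before` and `after` follow the order of `subsets`, so one subset is isolated by an equality of
  -- lists.
  subsets-split : (A : Subset n) → subsets n ≡ before A ++ A ∷ after A
  subsets-split []            = refl
  subsets-split (inside ∷ A)  = trans
    (cong (λ As → map (inside ∷_) As ++ _) (subsets-split A))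
    (trans (cong (_++ _) (List.map-++ (inside ∷_) (before A) (A ∷ after A)))
           (List.++-assoc (map (inside ∷_) (before A)) _ _))
  subsets-split (outside ∷ A) = trans
    (cong (λ As → _ ++ map (outside ∷_) As) (subsets-split A))
    (trans (cong (map (inside ∷_) (subsets _) ++_) (List.map-++ (outside ∷_) (before A) (A ∷ after A)))
           (sym (List.++-assoc (map (inside ∷_) (subsets _)) _ _)))

  private
    ≢-cong : ∀ {s} {A : Subset n} {As} → All (_≢ A) As → All (_≢ s ∷ A) (map (s ∷_) As)
    ≢-cong = All.map⁺ ∘ All.map (λ B≢A → B≢A ∘ Vec.∷-injectiveʳ)

  before-≢ : (A : Subset n) → All (_≢ A) (before A)
  before-≢ []            = []
  before-≢ (inside ∷ A)  = ≢-cong (before-≢ A)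
  before-≢ (outside ∷ A) = All.++⁺ (All.map⁺ (All.universal (λ _ ()) _)) (≢-cong (before-≢ A))

  after-≢ : (A : Subset n) → All (_≢ A) (after A)
  after-≢ []            = []
  after-≢ (inside ∷ A)  = All.++⁺ (≢-cong (after-≢ A)) (All.map⁺ (All.universal (λ _ ()) _))
  after-≢ (outside ∷ A) = ≢-cong (after-≢ A)

  others : AllComp → AllComp → List AllComp
  others (p , P) (q , Q) = map (p + q ,_)
    (termsOver P Q (before (first p q)) ++ termsOver P Q (after (first p q)))

  rank-others : ∀ G Q → All (λ R → rank R ≤ rank Q) (others (composition G) Q)
  rank-others G (q , Q) = All.map⁺ (All.++⁺ (all-terms (before-≢ A)) (all-terms (after-≢ A)))
    where
    d = proj₁ (composition G)
    P = proj₂ (composition G)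
    A = first d q
    all-terms : ∀ {As} → All (_≢ A) As → All (λ R → rank (d + q , R) ≤ rank (q , Q)) (termsOver P Q As)
    all-terms []                      = []
    all-terms (_∷_ {B} B≢A As≢A) with ∣ B ∣ ℕ.≟ d
    ... | yes e = rank-other G (q , Q) B e B≢A ∷ all-terms As≢A
    ... | no _  = all-terms As≢A

  module _ {c ℓ} (S : Ring c ℓ) where
    private
      module S = Ring S
    open Linear S
    open CommutativeSemigroupProperties S.+-commutativeSemigroup using (x∙yz≈y∙xz)
    open import Relation.Binary.Reasoning.Setoid S.setoid

    product-▷ : ∀ h P Q → product h P Q S.≈ h (P ▷ Q) S.+ ∑ (others P Q) h
    product-▷ h (p , P) (q , Q) = begin
      ∑ (termsOver P Q (subsets (p + q))) h′
        ≡⟨ cong (λ As → ∑ (termsOver P Q As) h′) (subsets-split A) ⟩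
      ∑ (termsOver P Q (before A ++ A ∷ after A)) h′
        ≡⟨ cong (λ Rs → ∑ Rs h′) (List.mapMaybe-++ _ (before A) (A ∷ after A)) ⟩
      ∑ (termsOver P Q (before A) ++ termsOver P Q (A ∷ after A)) h′
        ≡⟨ cong (λ Rs → ∑ (termsOver P Q (before A) ++ Rs) h′) (termsOver-∷ (after A)) ⟩
      ∑ (termsOver P Q (before A) ++ term P Q A (∣first∣ p q) ∷ termsOver P Q (after A)) h′
        ≈⟨ ∑-++ (termsOver P Q (before A)) _ h′ ⟩
      ∑ (termsOver P Q (before A)) h′ S.+ (h ((p , P) ▷ (q , Q)) S.+ ∑ (termsOver P Q (after A)) h′)
        ≈⟨ x∙yz≈y∙xz _ _ _ ⟩
      h ((p , P) ▷ (q , Q)) S.+ (∑ (termsOver P Q (before A)) h′ S.+ ∑ (termsOver P Q (after A)) h′)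
        ≈⟨ S.+-congˡ (∑-++ (termsOver P Q (before A)) _ h′) ⟨
      h ((p , P) ▷ (q , Q)) S.+ ∑ (termsOver P Q (before A) ++ termsOver P Q (after A)) h′
        ≡⟨ cong (h ((p , P) ▷ (q , Q)) S.+_) (∑-map (p + q ,_) (termsOver P Q (before A) ++ _) h) ⟨
      h ((p , P) ▷ (q , Q)) S.+ ∑ (others (p , P) (q , Q)) h ∎
      where
      A = first p q
      h′ : Comp (p + q) → S.Carrier
      h′ R = h (p + q , R)
      termsOver-∷ : ∀ As → termsOver P Q (A ∷ As) ≡ term P Q A (∣first∣ p q) ∷ termsOver P Q As
      termsOver-∷ As with ∣ A ∣ ℕ.≟ p
      -- The decision procedure returns its own proof of the cardinality, which is identified with
      -- `∣first∣` because equality in `ℕ` is irrelevant.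
      ... | yes e = cong (_∷ termsOver P Q As) (cong (term P Q A) (ℕ.≡-irrelevant e (∣first∣ p q)))
      ... | no ≢p = contradiction (∣first∣ p q) ≢p

open Factorization

-- Existence of the extension

module Extension {c ℓ} (S : Ring c ℓ) (f : Generator → Ring.Carrier S) where

  open Ring S renaming (-_ to neg; _≈_ to _≋_)
  open Linear S
  open RingProperties S using (-‿distribˡ-*)
  open import Relation.Binary.Reasoning.Setoid setoid

  private
    module T = IsRing T-isRing

    ∑-congᴬ : ∀ {x} {X : Set x} {xs : List X} {h k : X → Carrier} →
              All (λ x → h x ≋ k x) xs → ∑ xs h ≋ ∑ xs k
    ∑-congᴬ []         = refl
    ∑-congᴬ (eq ∷ eqs) = +-cong eq (∑-congᴬ eqs)

    ∑-*ʳ : ∀ {x} {X : Set x} (xs : List X) (h : X → Carrier) s → (∑ xs λ x → h x * s) ≋ ∑ xs h * s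
    ∑-*ʳ []       h s = sym (zeroˡ s)
    ∑-*ʳ (x ∷ xs) h s = trans (+-congˡ (∑-*ʳ xs h s)) (sym (distribʳ s _ _))

    transpose : ∀ {s t u} → s + t ≋ u → s ≋ u + neg t
    transpose {s} {t} {u} s+t≋u = begin
      s               ≈⟨ +-identityʳ s ⟨
      s + 0#          ≈⟨ +-congˡ (-‿inverseʳ t) ⟨
      s + (t + neg t) ≈⟨ +-assoc s t (neg t) ⟨
      s + t + neg t   ≈⟨ +-congʳ s+t≋u ⟩
      u + neg t       ∎

    transpose⁻ : ∀ {s t u} → s ≋ u + neg t → s + t ≋ u
    transpose⁻ {s} {t} {u} eq = begin
      s + t             ≈⟨ +-congʳ eq ⟩
      u + neg t + t     ≈⟨ +-assoc u (neg t) t ⟩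
      u + (neg t + t)   ≈⟨ +-congˡ (-‿inverseˡ t) ⟩
      u + 0#            ≈⟨ +-identityʳ u ⟩
      u                 ∎

    step : (AllComp → Carrier) → ∀ {P} →
           P ≡ ∅ ⊎ (Σ[ G ∈ Generator ] Σ[ Q ∈ AllComp ] P ≡ composition G ▷ Q) → Carrier
    step φ (inj₁ _)           = 1#
    step φ (inj₂ (G , Q , _)) = f G * φ Q + neg (∑ (others (composition G) Q) φ)

    -- The first argument bounds the rank, which decreases in the recursion.
    approx : ℕ → AllComp → Carrier
    approx zero    P = 1#
    approx (suc n) P = step (approx n) (factorize P)

    rank-others-≤ : ∀ {n} G Q → rank (composition G ▷ Q) ≤ suc n →
                    All (λ R → rank R ≤ n) (others (composition G) Q)
    rank-others-≤ G Q r = All.map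
      (λ R≤Q → ℕ.≤-trans R≤Q (ℕ.≤-pred (ℕ.≤-trans (rank-▷ G Q) r))) (rank-others G Q)

    rank-rest-≤ : ∀ {n} G Q → rank (composition G ▷ Q) ≤ suc n → rank Q ≤ n
    rank-rest-≤ G Q r = ℕ.≤-pred (ℕ.≤-trans (rank-▷ G Q) r)

    ¬rank-▷≤0 : ∀ G Q → ¬ (rank (composition G ▷ Q) ≤ 0)
    ¬rank-▷≤0 G Q r with () ← ℕ.≤-trans (rank-▷ G Q) r

    -- A shifted concatenation has positive rank, so under the bound 0 only `∅` remains, and there
    -- the default value `1#` is the correct one. Otherwise both recursions use the same
    -- factorization.
    approx-stable : ∀ m n P → rank P ≤ m → rank P ≤ n → approx m P ≋ approx n P
    approx-stable zero    zero    P _ _ = refl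
    approx-stable zero    (suc n) P r _ with factorize P
    ... | inj₁ _                = refl
    ... | inj₂ (G , Q , ≡.refl) = contradiction r (¬rank-▷≤0 G Q)
    approx-stable (suc m) zero    P _ r with factorize P
    ... | inj₁ _                = refl
    ... | inj₂ (G , Q , ≡.refl) = contradiction r (¬rank-▷≤0 G Q)
    approx-stable (suc m) (suc n) P r r′ with factorize P
    ... | inj₁ _                = refl
    ... | inj₂ (G , Q , ≡.refl) = +-cong
      (*-congˡ (approx-stable m n Q (rank-rest-≤ G Q r) (rank-rest-≤ G Q r′)))
      (-‿cong (∑-congᴬ (All.zipWith (λ {R} (s , s′) → approx-stable m n R s s′)
        (rank-others-≤ G Q r , rank-others-≤ G Q r′))))

  φ₀ : AllComp → Carrier
  φ₀ P = approx (rank P) P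

  φ₀-▷ : ∀ G Q → φ₀ (composition G ▷ Q) ≋ f G * φ₀ Q + neg (∑ (others (composition G) Q) φ₀)
  -- The rank is not syntactically a successor, so the bound is raised by one to let `approx`
  -- unfold. The factorization it finds is the given one by `▷-injective`.
  φ₀-▷ G Q = trans (approx-stable (rank P) (suc (rank P)) P ℕ.≤-refl (ℕ.n≤1+n _)) unfold
    where
    P = composition G ▷ Q
    unfold : step (approx (rank P)) (factorize P) ≋ f G * φ₀ Q + neg (∑ (others (composition G) Q) φ₀)
    unfold with factorize P
    ... | inj₁ P≡∅ = contradiction P≡∅ (▷-≢∅ G Q)
    ... | inj₂ (G′ , Q′ , e) with ▷-injective G Q G′ Q′ e
    ...   | ≡.refl , ≡.refl = +-cong
      (*-congˡ (approx-stable _ _ Q (rank-rest-≤ G Q (ℕ.n≤1+n _)) ℕ.≤-refl))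
      (-‿cong (∑-congᴬ (All.map (λ {R} r → approx-stable _ _ R r ℕ.≤-refl)
        (rank-others-≤ G Q (ℕ.n≤1+n _)))))

  product-φ₀ : ∀ G Q → product φ₀ (composition G) Q ≋ f G * φ₀ Q
  product-φ₀ G Q = trans (product-▷ S φ₀ (composition G) Q) (transpose⁻ (φ₀-▷ G Q))

  φ : T → Carrier
  φ = eval φ₀

  private
    eval-⟨⟩∗̂ : ∀ h P y → eval h (⟨ P ⟩ ∗̂ y) ≋ eval (product h P) y
    eval-⟨⟩∗̂ h P y = trans (eval-∗̂ h ⟨ P ⟩ y) (eval-⟨⟩ (λ P → eval (product h P) y) P)

    eval-⟨⟩∗̂⟨⟩ : ∀ h P Q → eval h (⟨ P ⟩ ∗̂ ⟨ Q ⟩) ≋ product h P Q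
    eval-⟨⟩∗̂⟨⟩ h P Q = trans (eval-⟨⟩∗̂ h P ⟨ Q ⟩) (eval-⟨⟩ (product h P) Q)

    φ-generator-∗̂ : ∀ G y → φ (⟨ composition G ⟩ ∗̂ y) ≋ f G * φ y
    φ-generator-∗̂ G y = begin
      φ (⟨ composition G ⟩ ∗̂ y)         ≈⟨ eval-⟨⟩∗̂ φ₀ (composition G) y ⟩
      eval (product φ₀ (composition G)) y ≈⟨ eval-cong (product-φ₀ G) y ⟩
      eval (λ Q → f G * φ₀ Q) y         ≈⟨ eval-*ˡ (f G) φ₀ y ⟩
      f G * φ y                         ∎

    -- `G ▷ Q` is `G ∗̂ Q` minus the other terms. Associativity turns `(G ∗̂ Q) ∗̂ y` into
    -- `G ∗̂ (Q ∗̂ y)`, where `φ-generator-∗̂` applies; `Q` and the other terms have smaller rank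
    -- and are covered by induction.
    φ-⟨⟩∗̂ : ∀ n P y → rank P ≤ n → eval (product φ₀ P) y ≋ φ₀ P * φ y
    φ-⟨⟩∗̂ n P y r with factorize P
    ... | inj₁ ≡.refl = begin
      eval (product φ₀ ∅) y   ≈⟨ eval-⟨⟩∗̂ φ₀ ∅ y ⟨
      φ (⟨ ∅ ⟩ ∗̂ y)           ≈⟨ eval-resp-≈ φ₀ {⟨ ∅ ⟩ ∗̂ y} {y} (T.*-identityˡ y) ⟩
      φ y                     ≈⟨ *-identityˡ _ ⟨
      1# * φ y                ∎
    φ-⟨⟩∗̂ zero    P y r | inj₂ (G , Q , ≡.refl) = contradiction r (¬rank-▷≤0 G Q)
    φ-⟨⟩∗̂ (suc n) P y r | inj₂ (G , Q , ≡.refl) = begin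
      k (composition G ▷ Q)                               ≈⟨ transpose split ⟩
      f G * φ₀ Q * φ y + neg (∑ os φ₀ * φ y)              ≈⟨ +-congˡ (-‿distribˡ-* _ _) ⟩
      f G * φ₀ Q * φ y + neg (∑ os φ₀) * φ y              ≈⟨ distribʳ (φ y) _ _ ⟨
      (f G * φ₀ Q + neg (∑ os φ₀)) * φ y                  ≈⟨ *-congʳ (φ₀-▷ G Q) ⟨
      φ₀ (composition G ▷ Q) * φ y                        ∎
      where
      -- Multiplication by `y` followed by `φ`, seen as a functional of the left factor, so that
      -- `product-▷` can be applied to it.
      k : AllComp → Carrier
      k X = eval (product φ₀ X) y
      os = others (composition G) Q
      g = ⟨ composition G ⟩
      b = ⟨ Q ⟩
      split : k (composition G ▷ Q) + ∑ os φ₀ * φ y ≋ f G * φ₀ Q * φ y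
      split = begin
        k (composition G ▷ Q) + ∑ os φ₀ * φ y             ≈⟨ +-congˡ (∑-*ʳ os φ₀ (φ y)) ⟨
        k (composition G ▷ Q) + ∑ os (λ R → φ₀ R * φ y)   ≈⟨ +-congˡ (∑-congᴬ (All.map (λ {R} → φ-⟨⟩∗̂ n R y) (rank-others-≤ G Q r))) ⟨
        k (composition G ▷ Q) + ∑ os k                    ≈⟨ product-▷ S k (composition G) Q ⟨
        product k (composition G) Q                       ≈⟨ eval-⟨⟩∗̂⟨⟩ k (composition G) Q ⟨
        eval k (g ∗̂ b)                                ≈⟨ eval-∗̂ φ₀ (g ∗̂ b) y ⟨
        φ (g ∗̂ b ∗̂ y)                                 ≈⟨ eval-resp-≈ φ₀ {g ∗̂ b ∗̂ y} {g ∗̂ (b ∗̂ y)} (T.*-assoc g b y) ⟩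
        φ (g ∗̂ (b ∗̂ y))                               ≈⟨ φ-generator-∗̂ G (b ∗̂ y) ⟩
        f G * φ (b ∗̂ y)                               ≈⟨ *-congˡ (eval-⟨⟩∗̂ φ₀ Q y) ⟩
        f G * k Q                                         ≈⟨ *-congˡ (φ-⟨⟩∗̂ n Q y (rank-rest-≤ G Q r)) ⟩
        f G * (φ₀ Q * φ y)                                ≈⟨ *-assoc _ _ _ ⟨
        f G * φ₀ Q * φ y                                  ∎

  φ-∗̂ : ∀ x y → φ (x ∗̂ y) ≋ φ x * φ y
  φ-∗̂ x y = begin
    φ (x ∗̂ y)                               ≈⟨ eval-∗̂ φ₀ x y ⟩
    eval (λ P → eval (product φ₀ P) y) x    ≈⟨ eval-cong (λ P → φ-⟨⟩∗̂ (rank P) P y ℕ.≤-refl) x ⟩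
    eval (λ P → φ₀ P * φ y) x               ≈⟨ eval-*ʳ (φ y) φ₀ x ⟩
    φ x * φ y                               ∎

  φ-isRingHomomorphism : IsRingHomomorphism 𝓣 rawRing φ
  φ-isRingHomomorphism = record
    { isSemiringHomomorphism = record
      { isNearSemiringHomomorphism = record
        { +-isMonoidHomomorphism = record
          { isMagmaHomomorphism = record
            { isRelHomomorphism = record { cong = λ {x} {y} → eval-resp-≈ φ₀ {x} {y} }
            ; homo              = eval-++ φ₀
            }
          ; ε-homo = refl
          }
        ; *-homo = φ-∗̂
        }
      ; 1#-homo = eval-⟨⟩ φ₀ ∅
      }
    ; -‿homo = eval-neg φ₀
    }

  -- Obtained by multiplying with the unit, which avoids unfolding the recursion at `G`.
  φ-generator : ∀ G → φ ⟨ composition G ⟩ ≋ f G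
  φ-generator G = begin
    φ g            ≈⟨ eval-resp-≈ φ₀ {g} {g ∗̂ e} (T.sym {g ∗̂ e} {g} (T.*-identityʳ g)) ⟩
    φ (g ∗̂ e)      ≈⟨ φ-generator-∗̂ G e ⟩
    f G * φ e      ≈⟨ *-congˡ (eval-⟨⟩ φ₀ ∅) ⟩
    f G * 1#       ≈⟨ *-identityʳ _ ⟩
    f G            ∎
    where
    g = ⟨ composition G ⟩
    e = ⟨ ∅ ⟩

  -- Uniqueness of the extension

  module Uniqueness (ψ : T → Carrier) (hom : IsRingHomomorphism 𝓣 rawRing ψ)
                    (ψ-generator : ∀ G → ψ ⟨ composition G ⟩ ≋ f G) where

    private
      module ψ = IsRingHomomorphism hom

      -- Scalars are built into the entries of formal sums, so compatibility with them is derived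
      -- from additivity: entries with the same composition merge up to `≈`.
      ψ-scalar : ∀ a P → ψ ((a , P) ∷ []) ≋ a · ψ ⟨ P ⟩
      ψ-scalar a P = additive⇒· (λ a → ψ ((a , P) ∷ [])) (λ a b →
        trans (ψ.⟦⟧-cong {(a ℤ.+ b , P) ∷ []} {(a , P) ∷ (b , P) ∷ []} (merge a b))
              (ψ.+-homo ((a , P) ∷ []) ((b , P) ∷ []))) a
        where
        merge : ∀ a b → ((a ℤ.+ b , P) ∷ []) ≈ ((a , P) ∷ (b , P) ∷ [])
        merge a b R with P ≟ R
        ... | yes _ = ℤ.+-assoc a b 0ℤ
        ... | no  _ = ≡.refl

      ψ≋eval : ∀ x → ψ x ≋ eval (ψ ∘ ⟨_⟩) x
      ψ≋eval []            = ψ.0#-homo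
      ψ≋eval ((a , P) ∷ x) =
        trans (ψ.+-homo ((a , P) ∷ []) x) (+-cong (ψ-scalar a P) (ψ≋eval x))

      -- Computing `ψ` on `G ∗̂ Q` once by multiplicativity and once term by term gives the
      -- recursion that defines `φ₀`.
      ψ≋φ₀ : ∀ n P → rank P ≤ n → ψ ⟨ P ⟩ ≋ φ₀ P
      ψ≋φ₀ n P r with factorize P
      ... | inj₁ ≡.refl = ψ.1#-homo
      ψ≋φ₀ zero    P r | inj₂ (G , Q , ≡.refl) = contradiction r (¬rank-▷≤0 G Q)
      ψ≋φ₀ (suc n) P r | inj₂ (G , Q , ≡.refl) = begin
        h (composition G ▷ Q)                   ≈⟨ transpose split ⟩
        f G * φ₀ Q + neg (∑ os φ₀)              ≈⟨ φ₀-▷ G Q ⟨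
        φ₀ (composition G ▷ Q)                  ∎
        where
        h = ψ ∘ ⟨_⟩
        os = others (composition G) Q
        g = ⟨ composition G ⟩
        b = ⟨ Q ⟩
        split : h (composition G ▷ Q) + ∑ os φ₀ ≋ f G * φ₀ Q
        split = begin
          h (composition G ▷ Q) + ∑ os φ₀   ≈⟨ +-congˡ (∑-congᴬ (All.map (λ {R} → ψ≋φ₀ n R) (rank-others-≤ G Q r))) ⟨
          h (composition G ▷ Q) + ∑ os h    ≈⟨ product-▷ S h (composition G) Q ⟨
          product h (composition G) Q       ≈⟨ eval-⟨⟩∗̂⟨⟩ h (composition G) Q ⟨
          eval h (g ∗̂ b)                ≈⟨ ψ≋eval (g ∗̂ b) ⟨
          ψ (g ∗̂ b)                     ≈⟨ ψ.*-homo g b ⟩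
          ψ g * ψ b                     ≈⟨ *-cong (ψ-generator G) (ψ≋φ₀ n Q (rank-rest-≤ G Q r)) ⟩
          f G * φ₀ Q                        ∎

    ψ≋φ : ∀ x → ψ x ≋ φ x
    ψ≋φ x = trans (ψ≋eval x) (eval-cong (λ P → ψ≋φ₀ (rank P) P ℕ.≤-refl) x)

theorem3p4 : ∀ {c ℓ} → IsFreeAlgebra 𝓣 (λ (G : Generator) → ⟨ composition G ⟩) c ℓ
theorem3p4 = record
  { isRing = T-isRing
  ; extend = λ S f → let open Extension S f in
      φ , (φ-isRingHomomorphism , φ-generator) ,
      λ ψ (hom , ψ-generator) → Uniqueness.ψ≋φ ψ hom ψ-generator
  }
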